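{- If $G$ is a finite graph of maximum average degree $d \geq 4$, then $\chi^\ast_{DP}(G) \geq d/(2\ln d)$.
   Context: All graphs are finite, without loops or multiple edges. The average degree of a graph with nonempty vertex set is $2|E|/|V|$; the maximum average degree of $G$ is the largest average degree of a subgraph of $G$ with nonempty vertex set. A cover of a graph $G$ is a pair $(L,H)$ where $H$ is a graph and $L\colon V(G)\to 2^{V(H)}$ satisfies: the sets $L(u)$, $u\in V(G)$, partition $V(H)$; each $H[L(u)]$ is complete; if there is an edge of $H$ between $L(u)$ and $L(v)$ with $u\neq v$ then $uv\in E(G)$; and for each $uv\in E(G)$ the edges of $H$ between $L(u)$ and $L(v)$ form a (not necessarily perfect, possibly empty) matching. The cover is $k$-fold if $|L(u)|=k$ for all $u$. Edges of $H$ joining different sets $L(u)\ne L(v)$ are cross-edges; $S\subseteq V(H)$ is quasi-independent if it spans no cross-edges. For $\eta\in[0,1]$, an $(\eta,(L,H))$-coloring of $G$ is a quasi-independent $S\subseteq V(H)$ with $|S\cap L(u)|\geq \eta|L(u)|$ for all $u\in V(G)$. For $k\in\mathbb{N}^+$, $\theta_{DP}(G,k)$ is the maximum $\eta\in[0,1]$ such that $G$ admits an $(\eta,\mathcal{H})$-coloring for every $k$-fold cover $\mathcal{H}$ of $G$, and $\chi_{DP}^\ast(G)=\inf\{\theta_{DP}(G,k)^{ -1}: k\in\mathbb{N}^+\}$. -}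

module Defs where

open import Data.Bool using (Bool; true; false; if_then_else_)
open import Data.Nat as ℕ using (ℕ; zero; suc; NonZero)
open import Data.Fin using (Fin; toℕ)
open import Data.Fin.Subset using (Subset; _∈_; ∣_∣; Nonempty)
open import Data.Integer using (+_)
open import Data.Rational using (ℚ; _/_; _+_; _*_; _≤_; 0ℚ; 1ℚ)
open import Data.Product using (Σ; _×_; ∃)
open import Data.Empty using (⊥)
open import Relation.Nullary using (does)
open import Relation.Binary.PropositionalEquality using (_≡_)

record Graph : Set where
  field
    n       : ℕ
    adj     : Fin n → Fin n → Bool
    adj-sym : ∀ u v → adj u v ≡ adj v u
    adj-irr : ∀ u → adj u u ≡ false
open Graph public

sumFin : (m : ℕ) → (Fin m → ℕ) → ℕ
sumFin zero    f = 0
sumFin (suc m) f = f Data.Fin.zero ℕ.+ sumFin m (λ i → f (Data.Fin.suc i))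

record Subgraph (G : Graph) : Set where
  field
    S      : Subset (n G)
    F      : Fin (n G) → Fin (n G) → Bool
    F-sym  : ∀ u v → F u v ≡ F v u
    F-sub  : ∀ u v → F u v ≡ true → (adj G u v ≡ true) × (u ∈ S) × (v ∈ S)
open Subgraph public

edgeCount : {G : Graph} → Subgraph G → ℕ
edgeCount {G} H =
  sumFin (n G) λ u → sumFin (n G) λ v →
    if does (toℕ u ℕ.<? toℕ v) then (if F H u v then 1 else 0) else 0

avgDeg : (e v : ℕ) → .{{NonZero v}} → ℚ
avgDeg e v = + (2 ℕ.* e) / v

IsMad : Graph → ℚ → Set
IsMad G d =
  (Σ (Subgraph G) λ H → Σ (NonZero ∣ S H ∣) λ nz →
      avgDeg (edgeCount H) ∣ S H ∣ {{nz}} ≡ d)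
  × (∀ (H : Subgraph G) (nz : NonZero ∣ S H ∣) →
      avgDeg (edgeCount H) ∣ S H ∣ {{nz}} ≤ d)

-- k-fold covers.  V(H) is represented as V(G) × Fin k, with L(u) = {u} × Fin k.
-- Only the cross-edges are recorded (edges inside L(u) are all present,
-- H[L(u)] being complete, and play no role in quasi-independence).
-- cross u v a b = true  iff  (u,a)(v,b) is a cross-edge of H.

record Cover (G : Graph) (k : ℕ) : Set where
  field
    cross       : Fin (n G) → Fin (n G) → Fin k → Fin k → Bool
    cross-sym   : ∀ u v a b → cross u v a b ≡ cross v u b a
    cross-adj   : ∀ u v a b → cross u v a b ≡ true → adj G u v ≡ true
    cross-match₁ : ∀ u v a b b′ → cross u v a b ≡ true → cross u v a b′ ≡ true → b ≡ b′
    cross-match₂ : ∀ u v a a′ b → cross u v a b ≡ true → cross u v a′ b ≡ true → a ≡ a′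
open Cover public

record Coloring {G : Graph} {k : ℕ} (𝓗 : Cover G k) (η : ℚ) : Set where
  field
    col       : Fin (n G) → Subset k
    quasi-ind : ∀ u v a b → cross 𝓗 u v a b ≡ true → a ∈ col u → b ∈ col v → ⊥
    large     : ∀ u → η * (+ k / 1) ≤ (+ ∣ col u ∣ / 1)

AdmitsAll : Graph → ℕ → ℚ → Set
AdmitsAll G k η = (𝓗 : Cover G k) → Coloring 𝓗 η

-- θ is θ_DP(G,k): the maximum η ∈ [0,1] such that G admits an
-- (η,𝓗)-coloring for every k-fold cover 𝓗.  (The maximum is always of
-- the form j/k, hence rational.)
IsThetaDP : Graph → ℕ → ℚ → Set
IsThetaDP G k θ =
  (0ℚ ≤ θ) × (θ ≤ 1ℚ) × AdmitsAll G k θ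
  × (∀ η → 0ℚ ≤ η → η ≤ 1ℚ → AdmitsAll G k η → η ≤ θ)

expTerm : ℚ → ℕ → ℚ
expTerm x zero    = 1ℚ
expTerm x (suc i) = expTerm x i * x * (+ 1 / suc i)

expPartial : ℚ → ℕ → ℚ
expPartial x zero    = 1ℚ
expPartial x (suc N) = expPartial x N + expTerm x (suc N)

-- For x ≥ 0 and d > 0:  x ≤ ln d  ⇔  exp x ≤ d  ⇔  every partial sum of
-- the exponential series at x is ≤ d.
LeLn : ℚ → ℚ → Set
LeLn x d = ∀ N → expPartial x N ≤ d

-- χ*_DP(G) ≥ d / (2 ln d), where χ*_DP(G) = inf_{k ≥ 1} θ_DP(G,k)^{-1}
-- (with 0^{-1} = ∞).  For d ≥ 4 this says: for every k ≥ 1,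
-- θ_DP(G,k)^{-1} ≥ d/(2 ln d), i.e. θ_DP(G,k) · d / 2 ≤ ln d.
ChiDPStarAtLeastDOver2LnD : Graph → ℚ → Set
ChiDPStarAtLeastDOver2LnD G d =
  ∀ k → NonZero k → ∀ θ → IsThetaDP G k θ → LeLn (θ * d * (+ 1 / 2)) d

{-# OPTIONS --safe #-}
module Submission where

-- First moment method.  Let H be a densest subgraph, with N vertices and
-- M = dN/2 edges, and put a uniformly random perfect matching over each edge of H.
-- A family of j-subsets of the lists L(u) is quasi-independent over one edge with
-- probability (k-j choose j) / (k choose j) ≤ (1 - j/k)^j.  If every cover is
-- colorable with j/k ≥ θ, then (k choose j)^N (1 - j/k)^(jM) ≥ 1.  As
-- (k choose j) ≤ (ek/j)^j, putting x = jM/(kN) and taking jN-th roots gives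
-- x exp x ≤ (e/2) d.  If x ≥ 11/8 ≥ e/2, then exp x ≤ d; otherwise
-- exp x ≤ exp (11/8) ≤ 4 ≤ d.

open import Defs

-- All arithmetic is natural or rational, so neither `e`, nor logarithms, nor roots are at hand. The
-- exponential enters only through (1 - t) exp (y + t) ≤ exp y, which iterates to exp (m t) ≤ (1 -
-- t)^(-m), and 11/4 stands for e. The room is small: the threshold c of the case split needs e/2 ≤
-- c for the large case and exp c ≤ 4 for the small one, that is 1.359... ≤ c ≤ 1.386...; this is
-- where d ≥ 4 comes in, and c = 11/8 fits. The j-th root is exact, since both sides are j-th
-- powers. The N-th root is not: 1 - j/k is replaced by the larger (1 - j/(kN))^N, which costs
-- nothing later because exp (jM/(kN)) ≤ (1 - j/(kN))^(-M) has the same exponent x. Multiplying exp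
-- x ≤ (11/4)(k/j) by x then cancels k/j and leaves M/N = d/2. No probability space of covers is
-- formed. The matchings are fixed one edge at a time, each chosen to keep at most the average
-- number of candidate colorings, so independence of the edges never has to be stated.

module FirstMoment where

  import Algebra.Properties.CommutativeMonoid.Sum
  open import Data.Bool using (Bool; true; false; not; _∧_; _∨_; if_then_else_; T)
  import Data.Bool.Properties as Bool
  open import Data.Empty using (⊥; ⊥-elim)
  open import Data.Fin as Fin using (Fin; zero; suc; toℕ; punchIn)
  open import Data.Fin.Properties using (punchIn-injective; punchInᵢ≢i)
  open import Data.Fin.Subset as Subset using (Subset; inside; outside; ∣_∣; _⊆_)
  open import Data.Fin.Subset.Properties using (∣⊥∣≡0; ∉⊥; in⊆in; out⊆; drop-there)
  open import Data.List as List using (List; []; _∷_; _++_; length; filter; cartesianProductWith)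
  open import Data.List.Membership.Propositional using (_∈_)
  open import Data.List.Membership.Propositional.Properties
    using (∈-filter⁺; ∈-map⁺; ∈-++⁺ˡ; ∈-++⁺ʳ; ∈-cartesianProductWith⁺; ∈-length)
  open import Data.List.Properties using (length-++; length-map)
  open import Data.List.Relation.Unary.All as All using (All; []; _∷_)
  import Data.List.Relation.Unary.All.Properties as All
  open import Data.List.Relation.Unary.Any using (here)
  open import Data.Nat
  open import Data.Nat.Properties
  open import Data.Nat.Tactic.RingSolver using (solve-∀)
  open import Data.Product using (∃; _,_; _×_; proj₁; proj₂)
  open import Data.Sum using (_⊎_; inj₁; inj₂)
  open import Data.Vec using (Vec; []; _∷_; lookup)
  import Data.Vec.Functional as Functional
  open import Data.Vec.Properties using (lookup⇒[]=)
  open import Function using (_∘_)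
  open import Relation.Binary.PropositionalEquality
  open import Relation.Nullary using (yes; no; does; contradiction)
  open import Relation.Nullary.Decidable using (dec-true)
  open Algebra.Properties.CommutativeMonoid.Sum +-0-commutativeMonoid
    using (sum; sum-remove; ∑-distrib-+; sum-cong-≗)

  -- Finite sums, averages and counts

  sumFin≡sum : ∀ m (f : Fin m → ℕ) → sumFin m f ≡ sum f
  sumFin≡sum zero    f = refl
  sumFin≡sum (suc m) f = cong (f zero +_) (sumFin≡sum m (f ∘ suc))

  sumFin-cong : ∀ m {f g : Fin m → ℕ} → (∀ i → f i ≡ g i) → sumFin m f ≡ sumFin m g
  sumFin-cong m {f} {g} f≗g = trans (sumFin≡sum m f) (trans (sum-cong-≗ f≗g) (sym (sumFin≡sum m g)))

  sumFin-distrib-+ : ∀ m (f g : Fin m → ℕ) → sumFin m (λ i → f i + g i) ≡ sumFin m f + sumFin m g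
  sumFin-distrib-+ m f g = begin
    sumFin m (λ i → f i + g i) ≡⟨ sumFin≡sum m _ ⟩
    sum (λ i → f i + g i)      ≡⟨ ∑-distrib-+ f g ⟩
    sum f + sum g              ≡⟨ cong₂ _+_ (sumFin≡sum m f) (sumFin≡sum m g) ⟨
    sumFin m f + sumFin m g    ∎
    where open ≡-Reasoning

  sumFin-remove : ∀ {m} (f : Fin (suc m) → ℕ) c →
    sumFin (suc m) f ≡ f c + sumFin m (f ∘ punchIn c)
  sumFin-remove {m} f c = begin
    sumFin (suc m) f               ≡⟨ sumFin≡sum (suc m) f ⟩
    sum f                          ≡⟨ sum-remove {i = c} f ⟩
    f c + sum (f ∘ punchIn c)      ≡⟨ cong (f c +_) (sumFin≡sum m _) ⟨
    f c + sumFin m (f ∘ punchIn c) ∎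
    where open ≡-Reasoning

  -- The smaller of the head and a term below the average of the tail is below the total average.
  average-bound : ∀ m (f : Fin (suc m) → ℕ) → ∃ λ i → f i * suc m ≤ sumFin (suc m) f
  average-bound zero    f = zero , ≤-reflexive (trans (*-identityʳ (f zero)) (sym (+-identityʳ (f zero))))
  average-bound (suc m) f with average-bound m (f ∘ suc)
  ... | i , fi*m≤s with ≤-total (f zero) (f (suc i))
  ...   | inj₁ f0≤fi = zero , (begin
    f zero * suc (suc m)                ≡⟨ *-suc (f zero) (suc m) ⟩
    f zero + f zero * suc m             ≤⟨ +-monoʳ-≤ (f zero) (*-monoˡ-≤ (suc m) f0≤fi) ⟩
    f zero + f (suc i) * suc m          ≤⟨ +-monoʳ-≤ (f zero) fi*m≤s ⟩
    f zero + sumFin (suc m) (f ∘ suc)   ∎)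
    where open ≤-Reasoning
  ...   | inj₂ fi≤f0 = suc i , (begin
    f (suc i) * suc (suc m)             ≡⟨ *-suc (f (suc i)) (suc m) ⟩
    f (suc i) + f (suc i) * suc m       ≤⟨ +-mono-≤ fi≤f0 fi*m≤s ⟩
    f zero + sumFin (suc m) (f ∘ suc)   ∎)
    where open ≤-Reasoning

  ind : Bool → ℕ
  ind b = if b then 1 else 0

  count : ∀ {m} → (Fin m → Bool) → ℕ
  count {m} B = sumFin m (ind ∘ B)

  count-not : ∀ {m} (B : Fin m → Bool) → count B + count (not ∘ B) ≡ m
  count-not {zero}  B = refl
  count-not {suc m} B with B zero
  ... | true  = cong suc (count-not (B ∘ suc))
  ... | false = trans (+-suc (count (B ∘ suc)) _) (cong suc (count-not (B ∘ suc)))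

  sumFin-if : ∀ {m} (B : Fin m → Bool) X Y →
    sumFin m (λ c → if B c then X else Y) ≡ count B * X + count (not ∘ B) * Y
  sumFin-if {zero}  B X Y = refl
  sumFin-if {suc m} B X Y with B zero
  ... | true  = trans (cong (X +_) (sumFin-if (B ∘ suc) X Y)) (sym (+-assoc X _ _))
  ... | false = trans (cong (Y +_) (sumFin-if (B ∘ suc) X Y)) (swap Y (count (B ∘ suc) * X) _)
    where
    swap : ∀ y u v → y + (u + v) ≡ u + (y + v)
    swap = solve-∀

  -- Permutations and averages over them

  -- A permutation coded by its value at zero and, after deletion of that value
  -- by punchIn, the permutation of the remaining points.
  data Perm : ℕ → Set where
    []  : Perm zero
    _∷_ : ∀ {m} → Fin (suc m) → Perm m → Perm (suc m)

  apply : ∀ {m} → Perm m → Fin m → Fin m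
  apply (c ∷ π) zero    = c
  apply (c ∷ π) (suc a) = punchIn c (apply π a)

  apply-injective : ∀ {m} (π : Perm m) {a b} → apply π a ≡ apply π b → a ≡ b
  apply-injective (c ∷ π) {zero}  {zero}  _  = refl
  apply-injective (c ∷ π) {zero}  {suc b} eq = contradiction (sym eq) (punchInᵢ≢i c _)
  apply-injective (c ∷ π) {suc a} {zero}  eq = contradiction eq (punchInᵢ≢i c _)
  apply-injective (c ∷ π) {suc a} {suc b} eq =
    cong suc (apply-injective π (punchIn-injective c _ _ eq))

  idPerm : ∀ m → Perm m
  idPerm zero    = []
  idPerm (suc m) = zero ∷ idPerm m

  sumPerm : ∀ m → (Perm m → ℕ) → ℕ
  sumPerm zero    g = g []
  sumPerm (suc m) g = sumFin (suc m) λ c → sumPerm m λ π → g (c ∷ π)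

  sumPerm-cong : ∀ m {f g : Perm m → ℕ} → (∀ π → f π ≡ g π) → sumPerm m f ≡ sumPerm m g
  sumPerm-cong zero    f≗g = f≗g []
  sumPerm-cong (suc m) f≗g = sumFin-cong (suc m) λ c → sumPerm-cong m λ π → f≗g (c ∷ π)

  sumPerm-zero : ∀ m → sumPerm m (λ _ → 0) ≡ 0
  sumPerm-zero zero    = refl
  sumPerm-zero (suc m) = trans (sumFin-cong (suc m) λ _ → sumPerm-zero m) (zeros (suc m))
    where
    zeros : ∀ n → sumFin n (λ _ → 0) ≡ 0
    zeros zero    = refl
    zeros (suc n) = zeros n

  sumPerm-distrib-+ : ∀ m (f g : Perm m → ℕ) →
    sumPerm m (λ π → f π + g π) ≡ sumPerm m f + sumPerm m g
  sumPerm-distrib-+ zero    f g = refl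
  sumPerm-distrib-+ (suc m) f g = trans
    (sumFin-cong (suc m) λ c → sumPerm-distrib-+ m (λ π → f (c ∷ π)) (λ π → g (c ∷ π)))
    (sumFin-distrib-+ (suc m) (λ c → sumPerm m λ π → f (c ∷ π)) (λ c → sumPerm m λ π → g (c ∷ π)))

  -- Conditional averages: the value at zero is fixed so that the sum over its completions is at
  -- most average, then the rest is chosen among these completions.
  average-bound-perm : ∀ m (g : Perm m → ℕ) → ∃ λ π → g π * m ! ≤ sumPerm m g
  average-bound-perm zero    g = [] , ≤-reflexive (*-identityʳ (g []))
  average-bound-perm (suc m) g
    with average-bound m (λ c → sumPerm m λ π → g (c ∷ π))
  ... | c , c-bound with average-bound-perm m (λ π → g (c ∷ π))
  ...   | π , π-bound = c ∷ π , (begin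
    g (c ∷ π) * (suc m * m !)               ≡⟨ regroup (g (c ∷ π)) (suc m) (m !) ⟩
    g (c ∷ π) * m ! * suc m                 ≤⟨ *-monoˡ-≤ (suc m) π-bound ⟩
    sumPerm m (λ π → g (c ∷ π)) * suc m     ≤⟨ c-bound ⟩
    sumPerm (suc m) g                       ∎)
    where
    open ≤-Reasoning
    regroup : ∀ x y z → x * (y * z) ≡ x * z * y
    regroup = solve-∀

  -- The condition that `π` maps no point of `A` into `B`, by recursion on the code of `π` so that
  -- it unfolds along with `sumPerm`; `punchIn c` pulls `B` back to the values still free.
  avoids : ∀ {m} → Perm m → (A B : Fin m → Bool) → Bool
  avoids []      A B = true
  avoids (c ∷ π) A B = not (A zero ∧ B c) ∧ avoids π (A ∘ suc) (B ∘ punchIn c)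

  avoids-complete : ∀ {m} (π : Perm m) A B →
    (∀ a → A a ≡ true → B (apply π a) ≡ true → ⊥) → avoids π A B ≡ true
  avoids-complete []      A B disj = refl
  avoids-complete (c ∷ π) A B disj with A zero in A0 | B c in Bc
  ... | true  | true  = ⊥-elim (disj zero A0 Bc)
  ... | true  | false = avoids-complete π _ _ (disj ∘ suc)
  ... | false | _     = avoids-complete π _ _ (disj ∘ suc)

  -- Falling factorials and the number of avoiding permutations

  falling : ℕ → ℕ → ℕ
  falling q zero    = 1
  falling q (suc a) = q * falling (pred q) a

  falling-suc : ∀ q a → falling q (suc a) ≡ falling q a * (q ∸ a)
  falling-suc q       zero    = trans (*-identityʳ q) (sym (*-identityˡ q))
  falling-suc zero    (suc a) = refl
  falling-suc (suc q) (suc a) = begin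
    suc q * falling q (suc a)         ≡⟨ cong (suc q *_) (falling-suc q a) ⟩
    suc q * (falling q a * (q ∸ a))   ≡⟨ *-assoc (suc q) (falling q a) (q ∸ a) ⟨
    suc q * falling q a * (q ∸ a)     ∎
    where open ≡-Reasoning

  falling≡0 : ∀ q a → q < a → falling q a ≡ 0
  falling≡0 zero    (suc a) _         = refl
  falling≡0 (suc q) (suc a) (s≤s q<a) = trans (cong (suc q *_) (falling≡0 q a q<a)) (*-zeroʳ (suc q))

  -- The form of `falling-suc` without truncated subtraction. It needs no `a ≤ q`: for `q < a` every
  -- term vanishes.
  falling-suc-+ : ∀ q a → falling q (suc a) + falling q a * a ≡ falling q a * q
  falling-suc-+ q a with a ≤? q
  ... | yes a≤q = begin
    falling q (suc a) + falling q a * a         ≡⟨ cong (_+ falling q a * a) (falling-suc q a) ⟩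
    falling q a * (q ∸ a) + falling q a * a     ≡⟨ *-distribˡ-+ (falling q a) (q ∸ a) a ⟨
    falling q a * (q ∸ a + a)                   ≡⟨ cong (falling q a *_) (m∸n+n≡m a≤q) ⟩
    falling q a * q                             ∎
    where open ≡-Reasoning
  ... | no a≰q rewrite falling≡0 q a (≰⇒> a≰q) =
    trans (+-identityʳ _) (falling≡0 q (suc a) (m≤n⇒m≤1+n (≰⇒> a≰q)))

  falling-! : ∀ k j → j ≤ k → falling k j * (k ∸ j) ! ≡ k !
  falling-! k       zero    _         = *-identityˡ (k !)
  falling-! (suc k) (suc j) (s≤s j≤k) =
    trans (*-assoc (suc k) (falling k j) _) (cong (suc k *_) (falling-! k j j≤k))

  -- Factor by factor, (q - i)/(k - i) ≤ q/k. With q = k - j and a = j this turns the exact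
  -- probability of avoidance into (1 - j/k)^j.
  falling-ratio : ∀ q k a → q ≤ k → falling q a * k ^ a ≤ falling k a * q ^ a
  falling-ratio q k zero    _   = ≤-refl
  falling-ratio q k (suc a) q≤k = begin
    falling q (suc a) * (k * k ^ a)           ≡⟨ cong (_* (k * k ^ a)) (falling-suc q a) ⟩
    falling q a * (q ∸ a) * (k * k ^ a)       ≡⟨ regroup (falling q a) (q ∸ a) k (k ^ a) ⟩
    falling q a * k ^ a * ((q ∸ a) * k)       ≤⟨ *-mono-≤ (falling-ratio q k a q≤k) step ⟩
    falling k a * q ^ a * ((k ∸ a) * q)       ≡⟨ regroup (falling k a) (k ∸ a) q (q ^ a) ⟨
    falling k a * (k ∸ a) * (q * q ^ a)       ≡⟨ cong (_* (q * q ^ a)) (falling-suc k a) ⟨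
    falling k (suc a) * (q * q ^ a)           ∎
    where
    open ≤-Reasoning
    regroup : ∀ f d x y → f * d * (x * y) ≡ f * y * (d * x)
    regroup = solve-∀
    step : (q ∸ a) * k ≤ (k ∸ a) * q
    step = begin
      (q ∸ a) * k     ≡⟨ *-distribʳ-∸ k q a ⟩
      q * k ∸ a * k   ≤⟨ ∸-mono (≤-reflexive (*-comm q k)) (*-monoʳ-≤ a q≤k) ⟩
      k * q ∸ a * q   ≡⟨ *-distribʳ-∸ q k a ⟨
      (k ∸ a) * q     ∎

  -- The points of `A` are sent injectively outside `B`, the others anywhere that remains. The
  -- induction exposes the image c of the first point: a c outside `B` uses up one allowed value, a
  -- c in `B` uses none and is forbidden when that point lies in `A`.
  sumPerm-avoids : ∀ {m} (A B : Fin m → Bool) →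
    sumPerm m (λ π → ind (avoids π A B)) ≡ count (not ∘ A) ! * falling (count (not ∘ B)) (count A)
  sumPerm-avoids {zero}  A B = refl
  sumPerm-avoids {suc m} A B with A zero
  ... | true = begin
    sumFin (suc m) (λ c → sumPerm m λ π → ind (not (B c) ∧ avoids π A′ (B ∘ punchIn c)))
      ≡⟨ sumFin-cong (suc m) summand ⟩
    sumFin (suc m) (λ c → if B c then 0 else r ! * falling (pred q) a)
      ≡⟨ sumFin-if B 0 (r ! * falling (pred q) a) ⟩
    count B * 0 + q * (r ! * falling (pred q) a)
      ≡⟨ regroup (count B) q (r !) (falling (pred q) a) ⟩
    r ! * (q * falling (pred q) a) ∎
    where
    open ≡-Reasoning
    A′ = A ∘ suc
    a = count A′
    r = count (not ∘ A′)
    q = count (not ∘ B)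
    regroup : ∀ b q r f → b * 0 + q * (r * f) ≡ r * (q * f)
    regroup = solve-∀
    summand : ∀ c → sumPerm m (λ π → ind (not (B c) ∧ avoids π A′ (B ∘ punchIn c)))
      ≡ (if B c then 0 else r ! * falling (pred q) a)
    summand c with B c in Bc
    ... | true  = sumPerm-zero m
    ... | false = trans (sumPerm-avoids A′ (B ∘ punchIn c))
      (cong (λ x → r ! * falling (pred x) a) (sym (trans (sumFin-remove (ind ∘ not ∘ B) c)
        (cong (λ x → ind (not x) + count (not ∘ B ∘ punchIn c)) Bc))))
  ... | false = begin
    sumFin (suc m) (λ c → sumPerm m λ π → ind (avoids π A′ (B ∘ punchIn c)))
      ≡⟨ sumFin-cong (suc m) summand ⟩
    sumFin (suc m) (λ c → if B c then r ! * falling q a else r ! * falling (pred q) a)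
      ≡⟨ sumFin-if B _ _ ⟩
    count B * (r ! * falling q a) + q * (r ! * falling (pred q) a)
      ≡⟨ regroup₁ (count B) q (r !) (falling q a) (falling (pred q) a) ⟩
    r ! * (count B * falling q a + falling q (suc a))
      -- After adding `falling q a * a`, both sides are `falling q a` times the number of points,
      -- counted as `count B + q` and as `suc r + a`.
      ≡⟨ cong (r ! *_) (+-cancelʳ-≡ (falling q a * a) _ _ both-sides) ⟩
    r ! * (falling q a * suc r)
      ≡⟨ regroup₂ (r !) (falling q a) (suc r) ⟩
    suc r * r ! * falling q a ∎
    where
    open ≡-Reasoning
    A′ = A ∘ suc
    a = count A′
    r = count (not ∘ A′)
    q = count (not ∘ B)
    regroup₁ : ∀ b q r f g → b * (r * f) + q * (r * g) ≡ r * (b * f + q * g)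
    regroup₁ = solve-∀
    regroup₂ : ∀ x f s → x * (f * s) ≡ s * x * f
    regroup₂ = solve-∀
    regroup₃ : ∀ b f x → b * f + f * x ≡ f * (b + x)
    regroup₃ = solve-∀
    both-sides : count B * falling q a + falling q (suc a) + falling q a * a
      ≡ falling q a * suc r + falling q a * a
    both-sides = begin
      count B * falling q a + falling q (suc a) + falling q a * a
        ≡⟨ +-assoc (count B * falling q a) _ _ ⟩
      count B * falling q a + (falling q (suc a) + falling q a * a)
        ≡⟨ cong (count B * falling q a +_) (falling-suc-+ q a) ⟩
      count B * falling q a + falling q a * q
        ≡⟨ regroup₃ (count B) (falling q a) q ⟩
      falling q a * (count B + q)
        ≡⟨ cong (falling q a *_) (trans (count-not B) (cong suc (sym (trans (+-comm r a) (count-not A′))))) ⟩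
      falling q a * (suc r + a)
        ≡⟨ *-distribˡ-+ (falling q a) (suc r) a ⟩
      falling q a * suc r + falling q a * a ∎
    summand : ∀ c → sumPerm m (λ π → ind (avoids π A′ (B ∘ punchIn c)))
      ≡ (if B c then r ! * falling q a else r ! * falling (pred q) a)
    summand c with B c in Bc
    ... | true  = trans (sumPerm-avoids A′ (B ∘ punchIn c))
      (cong (λ x → r ! * falling x a) (sym (trans (sumFin-remove (ind ∘ not ∘ B) c)
        (cong (λ x → ind (not x) + count (not ∘ B ∘ punchIn c)) Bc))))
    ... | false = trans (sumPerm-avoids A′ (B ∘ punchIn c))
      (cong (λ x → r ! * falling (pred x) a) (sym (trans (sumFin-remove (ind ∘ not ∘ B) c)
        (cong (λ x → ind (not x) + count (not ∘ B ∘ punchIn c)) Bc))))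

  -- Successive choice of matchings

  -- A derandomised averaging step: some x ∈ X leaves at most the fraction
  -- (Q / K) ^ e of any list of P-candidates related to x by R.
  Shrinks : {X A : Set} (P : A → Set) (K Q : ℕ) (R : X → A → Set) (e : ℕ) → Set
  Shrinks P K Q R e = ∀ L → All P L → ∃ λ x → ∃ λ L′ →
    (∀ {s} → s ∈ L → R x s → s ∈ L′) × All P L′ × length L′ * K ^ e ≤ length L * Q ^ e

  -- Each choice acts on the survivors of the previous ones, so the factors multiply and the
  -- exponents add. This holds because a step is required to work for every list of `P`-candidates
  -- and to return such a list.
  shrinks-Fin : ∀ {X A : Set} {P : A → Set} {K Q} p (R : Fin p → X → A → Set) (e : Fin p → ℕ) →
    (∀ i → Shrinks P K Q (R i) (e i)) →
    Shrinks P K Q (λ (x : Fin p → X) s → ∀ i → R i (x i) s) (sumFin p e)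
  shrinks-Fin zero R e step L PL = (λ ()) , L , (λ s∈L _ → s∈L) , PL , ≤-refl
  shrinks-Fin {K = K} {Q} (suc p) R e step L PL
    with x , L₁ , keep₁ , PL₁ , bound₁ ← step zero L PL
    with y , L₂ , keep₂ , PL₂ , bound₂ ← shrinks-Fin p (R ∘ suc) (e ∘ suc) (step ∘ suc) L₁ PL₁
    = x Functional.∷ y , L₂ , (λ s∈L r → keep₂ (keep₁ s∈L (r zero)) (r ∘ suc)) , PL₂ , (begin
    length L₂ * K ^ (e₀ + E)        ≡⟨ cong (length L₂ *_) (^-distribˡ-+-* K e₀ E) ⟩
    length L₂ * (K ^ e₀ * K ^ E)    ≡⟨ regroup₁ (length L₂) (K ^ e₀) (K ^ E) ⟩
    length L₂ * K ^ E * K ^ e₀      ≤⟨ *-monoˡ-≤ (K ^ e₀) bound₂ ⟩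
    length L₁ * Q ^ E * K ^ e₀      ≡⟨ regroup₂ (length L₁) (Q ^ E) (K ^ e₀) ⟩
    length L₁ * K ^ e₀ * Q ^ E      ≤⟨ *-monoˡ-≤ (Q ^ E) bound₁ ⟩
    length L * Q ^ e₀ * Q ^ E       ≡⟨ *-assoc (length L) (Q ^ e₀) (Q ^ E) ⟩
    length L * (Q ^ e₀ * Q ^ E)     ≡⟨ cong (length L *_) (^-distribˡ-+-* Q e₀ E) ⟨
    length L * Q ^ (e₀ + E)         ∎)
    where
    open ≤-Reasoning
    e₀ = e zero
    E = sumFin p (e ∘ suc)
    regroup₁ : ∀ l x y → l * (x * y) ≡ l * y * x
    regroup₁ = solve-∀
    regroup₂ : ∀ l x y → l * x * y ≡ l * y * x
    regroup₂ = solve-∀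

  ∣_∣≡count : ∀ {m} (p : Subset m) → ∣ p ∣ ≡ count (lookup p)
  ∣ []          ∣≡count = refl
  ∣ inside  ∷ p ∣≡count = cong suc ∣ p ∣≡count
  ∣ outside ∷ p ∣≡count = ∣ p ∣≡count

  count-not-lookup : ∀ {m} (p : Subset m) → count (not ∘ lookup p) ≡ m ∸ ∣ p ∣
  count-not-lookup {m} p = begin
    count (not ∘ lookup p)                                        ≡⟨ m+n∸m≡n (count (lookup p)) _ ⟨
    count (lookup p) + count (not ∘ lookup p) ∸ count (lookup p)
      ≡⟨ cong₂ _∸_ (count-not (lookup p)) (sym ∣ p ∣≡count) ⟩
    m ∸ ∣ p ∣                                                     ∎
    where open ≡-Reasoning

  module _ {A : Set} {k : ℕ} (α β : A → Subset k) where

    survivors : Perm k → List A → List A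
    survivors π = filter (λ s → avoids π (lookup (α s)) (lookup (β s)) Bool.≟ true)

    -- Linearity of expectation: the sums over permutations and over candidates are exchanged, and
    -- every candidate contributes the same number, as only the sizes of its two sets matter.
    sumPerm-survivors : ∀ {j} L → All (λ s → ∣ α s ∣ ≡ j × ∣ β s ∣ ≡ j) L →
      sumPerm k (λ π → length (survivors π L)) ≡ length L * ((k ∸ j) ! * falling (k ∸ j) j)
    sumPerm-survivors []      []                       = sumPerm-zero k
    sumPerm-survivors {j} (s ∷ L) ((∣αs∣≡j , ∣βs∣≡j) ∷ PL) = begin
      sumPerm k (λ π → length (survivors π (s ∷ L)))
        ≡⟨ sumPerm-cong k split ⟩
      sumPerm k (λ π → ind (avoids π (lookup (α s)) (lookup (β s))) + length (survivors π L))
        ≡⟨ sumPerm-distrib-+ k (λ π → ind (avoids π (lookup (α s)) (lookup (β s)))) _ ⟩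
      sumPerm k (λ π → ind (avoids π (lookup (α s)) (lookup (β s)))) + sumPerm k (λ π → length (survivors π L))
        ≡⟨ cong₂ _+_ (trans (sumPerm-avoids (lookup (α s)) (lookup (β s))) sizes) (sumPerm-survivors L PL) ⟩
      suc (length L) * ((k ∸ j) ! * falling (k ∸ j) j) ∎
      where
      open ≡-Reasoning
      split : ∀ π → length (survivors π (s ∷ L))
        ≡ ind (avoids π (lookup (α s)) (lookup (β s))) + length (survivors π L)
      split π with avoids π (lookup (α s)) (lookup (β s))
      ... | true  = refl
      ... | false = refl
      sizes : count (not ∘ lookup (α s)) ! * falling (count (not ∘ lookup (β s))) (count (lookup (α s)))
        ≡ (k ∸ j) ! * falling (k ∸ j) j
      sizes rewrite count-not-lookup (α s) | count-not-lookup (β s) | sym ∣ α s ∣≡count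
        | ∣αs∣≡j | ∣βs∣≡j = refl

    -- One edge of the graph, hence exponent 1. A permutation at most as good as average for the
    -- candidates is taken; `falling-!` turns (k - j)! times a falling factorial into the number k!
    -- of permutations, which cancels.
    shrinks-Perm : ∀ {P : A → Set} {j} → j ≤ k → (∀ {s} → P s → ∣ α s ∣ ≡ j × ∣ β s ∣ ≡ j) →
      Shrinks P (k ^ j) ((k ∸ j) ^ j)
        (λ π s → ∀ a → a Subset.∈ α s → apply π a Subset.∈ β s → ⊥) 1
    shrinks-Perm {j = j} j≤k sizes L PL
      with π , bound ← average-bound-perm k (λ π → length (survivors π L))
      = π , survivors π L
      , (λ {s} s∈L disj → ∈-filter⁺ (λ s → avoids π (lookup (α s)) (lookup (β s)) Bool.≟ true) s∈L
          (avoids-complete π _ _ λ a αa βa → disj a (lookup⇒[]= _ _ αa) (lookup⇒[]= _ _ βa)))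
      , All.filter⁺ _ PL
      , *-cancelʳ-≤ _ _ (k !) {{>-nonZero (1≤n! k)}} (begin
      l′ * (k ^ j * 1) * k !                                 ≡⟨ regroup₁ l′ (k ^ j) (k !) ⟩
      l′ * k ! * k ^ j                                       ≤⟨ *-monoˡ-≤ (k ^ j) bound ⟩
      sumPerm k (λ π → length (survivors π L)) * k ^ j
        ≡⟨ cong (_* k ^ j) (sumPerm-survivors L (All.map sizes PL)) ⟩
      l * ((k ∸ j) ! * falling (k ∸ j) j) * k ^ j
        ≡⟨ regroup₂ l ((k ∸ j) !) (falling (k ∸ j) j) (k ^ j) ⟩
      l * ((k ∸ j) ! * (falling (k ∸ j) j * k ^ j))
        ≤⟨ *-monoʳ-≤ l (*-monoʳ-≤ ((k ∸ j) !) (falling-ratio (k ∸ j) k j (m∸n≤m k j))) ⟩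
      l * ((k ∸ j) ! * (falling k j * (k ∸ j) ^ j))
        ≡⟨ regroup₃ l ((k ∸ j) !) (falling k j) ((k ∸ j) ^ j) ⟩
      l * ((k ∸ j) ^ j * 1) * (falling k j * (k ∸ j) !)
        ≡⟨ cong (l * ((k ∸ j) ^ j * 1) *_) (falling-! k j j≤k) ⟩
      l * ((k ∸ j) ^ j * 1) * k !                            ∎)
      where
      open ≤-Reasoning
      l = length L
      l′ = length (survivors π L)
      regroup₁ : ∀ x y z → x * (y * 1) * z ≡ x * z * y
      regroup₁ = solve-∀
      regroup₂ : ∀ l x y z → l * (x * y) * z ≡ l * (x * (y * z))
      regroup₂ = solve-∀
      regroup₃ : ∀ l x y z → l * (x * (y * z)) ≡ l * (z * 1) * (y * x)
      regroup₃ = solve-∀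

  -- Subsets of fixed size and assignments on a vertex set

  subsets : ∀ k → ℕ → List (Subset k)
  subsets zero    zero    = List.[ [] ]
  subsets zero    (suc j) = []
  subsets (suc k) zero    = List.map (outside ∷_) (subsets k zero)
  subsets (suc k) (suc j) = List.map (inside ∷_) (subsets k j) ++ List.map (outside ∷_) (subsets k (suc j))

  subsets-sound : ∀ k j → All (λ p → ∣ p ∣ ≡ j) (subsets k j)
  subsets-sound zero    zero    = refl ∷ []
  subsets-sound zero    (suc j) = []
  subsets-sound (suc k) zero    = All.map⁺ (subsets-sound k zero)
  subsets-sound (suc k) (suc j) =
    All.++⁺ (All.map⁺ (All.map (cong suc) (subsets-sound k j))) (All.map⁺ (subsets-sound k (suc j)))

  subsets-complete : ∀ {k} (p : Subset k) → p ∈ subsets k ∣ p ∣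
  subsets-complete []            = here refl
  subsets-complete (inside  ∷ p) = ∈-++⁺ˡ (∈-map⁺ (inside ∷_) (subsets-complete p))
  subsets-complete (outside ∷ p) with ∣ p ∣ | subsets-complete p
  ... | zero  | p∈ = ∈-map⁺ (outside ∷_) p∈
  ... | suc j | p∈ = ∈-++⁺ʳ _ (∈-map⁺ (outside ∷_) p∈)

  -- Pascal's rule reduces the claim to `binomial`, which keeps just two terms of the expansion of
  -- (k + 1)^(j + 1).
  length-subsets : ∀ k j → length (subsets k j) * j ! ≤ k ^ j
  length-subsets zero    zero    = ≤-refl
  length-subsets zero    (suc j) = z≤n
  length-subsets (suc k) zero    = ≤-trans
    (≤-reflexive (cong (_* 1) (length-map (outside ∷_) (subsets k zero)))) (length-subsets k zero)
  length-subsets (suc k) (suc j) = begin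
    length (subsets (suc k) (suc j)) * (suc j * j !)
      ≡⟨ cong (_* (suc j * j !)) (trans (length-++ (List.map (inside ∷_) (subsets k j)))
           (cong₂ _+_ (length-map _ (subsets k j)) (length-map _ (subsets k (suc j))))) ⟩
    (length (subsets k j) + length (subsets k (suc j))) * (suc j * j !)
      ≡⟨ regroup (length (subsets k j)) (length (subsets k (suc j))) (suc j) (j !) ⟩
    suc j * (length (subsets k j) * j !) + length (subsets k (suc j)) * (suc j * j !)
      ≤⟨ +-mono-≤ (*-monoʳ-≤ (suc j) (length-subsets k j)) (length-subsets k (suc j)) ⟩
    suc j * k ^ j + k ^ suc j
      ≤⟨ binomial k j ⟩
    suc k ^ suc j ∎
    where
    open ≤-Reasoning
    regroup : ∀ x y s f → (x + y) * (s * f) ≡ s * (x * f) + y * (s * f)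
    regroup = solve-∀
    regroup′ : ∀ k j x → (1 + (1 + j)) * (k * x) + k * (k * x) + (1 + j) * x
      ≡ (1 + k) * ((1 + j) * x + k * x)
    regroup′ = solve-∀
    binomial : ∀ k j → suc j * k ^ j + k ^ suc j ≤ suc k ^ suc j
    binomial k zero    = ≤-reflexive (solve₁ k)
      where
      solve₁ : ∀ k → 1 + k * 1 ≡ (1 + k) * 1
      solve₁ = solve-∀
    binomial k (suc j) = begin
      suc (suc j) * (k * k ^ j) + k * (k * k ^ j)                  ≤⟨ m≤m+n _ (suc j * k ^ j) ⟩
      suc (suc j) * (k * k ^ j) + k * (k * k ^ j) + suc j * k ^ j  ≡⟨ regroup′ k j (k ^ j) ⟩
      suc k * (suc j * k ^ j + k * k ^ j)                          ≤⟨ *-monoʳ-≤ (suc k) (binomial k j) ⟩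
      suc k * suc k ^ suc j                                        ∎

  shrink-⊆ : ∀ {k} (p : Subset k) {j} → j ≤ ∣ p ∣ → ∃ λ q → q ⊆ p × ∣ q ∣ ≡ j
  shrink-⊆ {k} p {zero} _ = Subset.⊥ , (λ x∈⊥ → contradiction x∈⊥ ∉⊥) , ∣⊥∣≡0 k
  shrink-⊆ (inside  ∷ p) {suc j} (s≤s j≤∣p∣) with q , q⊆p , ∣q∣≡j ← shrink-⊆ p j≤∣p∣
    = inside ∷ q , in⊆in q⊆p , cong suc ∣q∣≡j
  shrink-⊆ (outside ∷ p) {suc j} j≤∣p∣       with q , q⊆p , ∣q∣≡j ← shrink-⊆ p j≤∣p∣
    = outside ∷ q , out⊆ q⊆p , ∣q∣≡j

  length-cartesianProductWith : ∀ {A B C : Set} (f : A → B → C) xs ys →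
    length (cartesianProductWith f xs ys) ≡ length xs * length ys
  length-cartesianProductWith f []       ys = refl
  length-cartesianProductWith f (x ∷ xs) ys = trans (length-++ (List.map (f x) ys))
    (cong₂ _+_ (length-map (f x) ys) (length-cartesianProductWith f xs ys))

  module _ {A : Set} (xs : List A) (default : A) where

    -- The default outside `S` keeps the exponent in the count equal to the number of vertices of
    -- the subgraph, not of the whole graph, while a candidate is still indexed by all vertices.
    assignments : ∀ {n} → Subset n → List (Vec A n)
    assignments []            = List.[ [] ]
    assignments (inside  ∷ S) = cartesianProductWith _∷_ xs (assignments S)
    assignments (outside ∷ S) = List.map (default ∷_) (assignments S)

    length-assignments : ∀ {n} (S : Subset n) → length (assignments S) ≡ length xs ^ ∣ S ∣
    length-assignments []            = refl
    length-assignments (inside  ∷ S) = trans (length-cartesianProductWith _∷_ xs (assignments S))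
      (cong (length xs *_) (length-assignments S))
    length-assignments (outside ∷ S) = trans (length-map (default ∷_) (assignments S)) (length-assignments S)

    assignments-sound : ∀ {n} {P : A → Set} (S : Subset n) → All P xs →
      All (λ s → ∀ u → u Subset.∈ S → P (lookup s u)) (assignments S)
    assignments-sound []            Pxs = (λ _ ()) ∷ []
    assignments-sound (inside  ∷ S) Pxs = All.cartesianProductWith⁺ (setoid A) (setoid _) _∷_ xs (assignments S)
      λ x∈xs s∈ → λ where
        zero    _   → All.lookup Pxs x∈xs
        (suc u) u∈S → All.lookup (assignments-sound S Pxs) s∈ u (drop-there u∈S)
    assignments-sound (outside ∷ S) Pxs = All.map⁺ (All.map (λ Ps → λ where
        (suc u) u∈S → Ps u (drop-there u∈S)) (assignments-sound S Pxs))

    assignments-complete : ∀ {n} (S : Subset n) (f : Fin n → A) → (∀ u → f u ∈ xs) →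
      ∃ λ s → s ∈ assignments S × (∀ u → u Subset.∈ S → lookup s u ≡ f u)
    assignments-complete []            f f∈xs = [] , here refl , λ ()
    assignments-complete (side ∷ S) f f∈xs
      with assignments-complete S (f ∘ suc) (f∈xs ∘ suc) | side
    ... | s , s∈ , s≡f | inside  = f zero ∷ s , ∈-cartesianProductWith⁺ _∷_ (f∈xs zero) s∈ , λ where
        zero    _   → refl
        (suc u) u∈S → s≡f u (drop-there u∈S)
    ... | s , s∈ , s≡f | outside = default ∷ s , ∈-map⁺ (default ∷_) s∈ , λ where
        (suc u) u∈S → s≡f u (drop-there u∈S)

  -- The cover built from permutations, and the first moment bound

  module _ {G : Graph} (H : Subgraph G) {k : ℕ} (Π : Fin (n G) → Fin (n G) → Perm k) where

    -- Only the values Π u v with u < v matter: Π u v is the matching over the edge uv.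
    Matched : (u v : Fin (n G)) (a b : Fin k) → Set
    Matched u v a b = toℕ u < toℕ v × apply (Π u v) a ≡ b

    matched : (u v : Fin (n G)) (a b : Fin k) → Bool
    matched u v a b = does (toℕ u <? toℕ v) ∧ does (apply (Π u v) a Fin.≟ b)

    matched-sound : ∀ u v a b → matched u v a b ≡ true → Matched u v a b
    matched-sound u v a b eq with toℕ u <ᵇ toℕ v in u<ᵇv | apply (Π u v) a Fin.≟ b
    matched-sound u v a b refl | true | yes πa≡b = <ᵇ⇒< _ _ (subst T (sym u<ᵇv) _) , πa≡b

    matched-complete : ∀ u v a b → Matched u v a b → matched u v a b ≡ true
    matched-complete u v a b (u<v , πa≡b) = cong₂ _∧_
      (dec-true (toℕ u <? toℕ v) u<v) (dec-true (apply (Π u v) a Fin.≟ b) πa≡b)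

    crossH : (u v : Fin (n G)) (a b : Fin k) → Bool
    crossH u v a b = F H u v ∧ (matched u v a b ∨ matched v u b a)

    crossH-sound : ∀ u v a b → crossH u v a b ≡ true →
      F H u v ≡ true × (Matched u v a b ⊎ Matched v u b a)
    crossH-sound u v a b eq with F H u v | matched u v a b in uv | matched v u b a in vu
    crossH-sound u v a b refl | true | true  | _    = refl , inj₁ (matched-sound u v a b uv)
    crossH-sound u v a b refl | true | false | true = refl , inj₂ (matched-sound v u b a vu)

    crossH-complete : ∀ u v a b → F H u v ≡ true → Matched u v a b → crossH u v a b ≡ true
    crossH-complete u v a b Fuv m = cong₂ _∧_ Fuv (cong (_∨ matched v u b a) (matched-complete u v a b m))

    crossH-sym : ∀ u v a b → crossH u v a b ≡ crossH v u b a
    crossH-sym u v a b = cong₂ _∧_ (F-sym H u v) (Bool.∨-comm (matched u v a b) (matched v u b a))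

    -- Read from the smaller vertex, a matching is a function; read from the larger, it is
    -- injective. The mixed cases would order u and v both ways.
    crossH-match : ∀ u v a b b′ → crossH u v a b ≡ true → crossH u v a b′ ≡ true → b ≡ b′
    crossH-match u v a b b′ eq eq′ with proj₂ (crossH-sound u v a b eq) | proj₂ (crossH-sound u v a b′ eq′)
    ... | inj₁ (_   , πa≡b) | inj₁ (_   , πa≡b′) = trans (sym πa≡b) πa≡b′
    ... | inj₁ (u<v , _)    | inj₂ (v<u , _)     = contradiction v<u (<-asym u<v)
    ... | inj₂ (v<u , _)    | inj₁ (u<v , _)     = contradiction v<u (<-asym u<v)
    ... | inj₂ (_   , πb≡a) | inj₂ (_   , πb′≡a) = apply-injective (Π v u) (trans πb≡a (sym πb′≡a))

    permCover : Cover G k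
    permCover = record
      { cross        = crossH
      ; cross-sym    = crossH-sym
      ; cross-adj    = λ u v a b eq → proj₁ (F-sub H u v (proj₁ (crossH-sound u v a b eq)))
      ; cross-match₁ = crossH-match
      ; cross-match₂ = λ u v a a′ b eq eq′ → crossH-match v u b a a′
          (trans (crossH-sym v u b a) eq) (trans (crossH-sym v u b a′) eq′)
      }

  QuasiIndependent : ∀ {G k} → Cover G k → (Fin (n G) → Subset k) → Set
  QuasiIndependent 𝓗 col = ∀ u v a b → cross 𝓗 u v a b ≡ true → a Subset.∈ col u → b Subset.∈ col v → ⊥

  module _ {G : Graph} (H : Subgraph G) {k j : ℕ} (j≤k : j ≤ k) where

    Avoid : (u v : Fin (n G)) → Perm k → Vec (Subset k) (n G) → Set
    Avoid u v π s = toℕ u < toℕ v → F H u v ≡ true →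
      ∀ a → a Subset.∈ lookup s u → apply π a Subset.∈ lookup s v → ⊥

    -- The exponent is the summand of `edgeCount H`, so summing over all ordered pairs gives exactly
    -- the number of edges. For any other pair it is 0, and an arbitrary permutation with the
    -- unchanged list will do.
    shrinks-pair : ∀ u v → Shrinks (λ s → ∀ w → w Subset.∈ S H → ∣ lookup s w ∣ ≡ j)
      (k ^ j) ((k ∸ j) ^ j) (Avoid u v)
      (if does (toℕ u <? toℕ v) then (if F H u v then 1 else 0) else 0)
    shrinks-pair u v L PL with toℕ u <ᵇ toℕ v in u<ᵇv | F H u v in Fuv
    ... | false | _     = idPerm k , L , (λ s∈L _ → s∈L) , PL , ≤-refl
    ... | true  | false = idPerm k , L , (λ s∈L _ → s∈L) , PL , ≤-refl
    ... | true  | true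
      with _ , u∈S , v∈S ← F-sub H u v Fuv
      with π , L′ , keep , PL′ , bound ←
        shrinks-Perm (λ s → lookup s u) (λ s → lookup s v) j≤k (λ Ps → Ps u u∈S , Ps v v∈S) L PL
      = π , L′ , (λ s∈L avoid → keep s∈L (avoid (<ᵇ⇒< _ _ (subst T (sym u<ᵇv) _)) refl)) , PL′ , bound

    -- The hypothesis, applied to the cover made of the chosen matchings, provides a coloring that
    -- no step has discarded. So the final list `L′` is nonempty, against its upper bound.
    first-moment :
      (∀ (𝓗 : Cover G k) → ∃ λ col → QuasiIndependent 𝓗 col × (∀ u → ∣ col u ∣ ≡ j)) →
      (k ^ j) ^ edgeCount H ≤ length (subsets k j) ^ ∣ S H ∣ * ((k ∸ j) ^ j) ^ edgeCount H
    first-moment colorable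
      with Π , L′ , keep , _ , bound ←
        shrinks-Fin (n G) _ _ (λ u → shrinks-Fin (n G) _ _ (shrinks-pair u))
          (assignments (subsets k j) Subset.⊥ (S H))
          (assignments-sound (subsets k j) Subset.⊥ (S H) (subsets-sound k j))
      with col , indep , size ← colorable (permCover H Π)
      with s , s∈ , s≡col ← assignments-complete (subsets k j) Subset.⊥ (S H) col
        (λ u → subst (λ i → col u ∈ subsets k i) (size u) (subsets-complete (col u)))
      = begin
      (k ^ j) ^ M                                ≡⟨ *-identityˡ _ ⟨
      1 * (k ^ j) ^ M                            ≤⟨ *-monoˡ-≤ ((k ^ j) ^ M) (∈-length (keep s∈ s-avoids)) ⟩
      length L′ * (k ^ j) ^ M                    ≤⟨ bound ⟩
      length (assignments (subsets k j) Subset.⊥ (S H)) * ((k ∸ j) ^ j) ^ M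
        ≡⟨ cong (_* ((k ∸ j) ^ j) ^ M) (length-assignments (subsets k j) Subset.⊥ (S H)) ⟩
      length (subsets k j) ^ ∣ S H ∣ * ((k ∸ j) ^ j) ^ M ∎
      where
      open ≤-Reasoning
      M = edgeCount H
      -- Both ends of an edge of `H` lie in `S H`, where the candidate s agrees with the coloring.
      s-avoids : ∀ u v → Avoid u v (Π u v) s
      s-avoids u v u<v Fuv a a∈ πa∈ with _ , u∈S , v∈S ← F-sub H u v Fuv
        rewrite s≡col u u∈S | s≡col v v∈S =
        indep u v a (apply (Π u v) a) (crossH-complete H Π u v a _ Fuv (u<v , refl)) a∈ πa∈

open FirstMoment
open import Data.Fin.Subset as Subset using (∣_∣)
import Data.Integer as ℤ
open import Data.Integer using (+_)
import Data.Integer.Properties as ℤ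
open import Data.Nat as ℕ using (ℕ; zero; suc; _!; z≤n; s≤s)
import Data.Nat.Properties as ℕ
import Data.Nat.Tactic.RingSolver as ℕ-RingSolver
open import Data.Product using (∃; _,_; _×_; proj₁; proj₂)
open import Data.Rational hiding (∣_∣)
open import Data.Rational.Properties
open import Data.Rational.Solver using (module +-*-Solver)
open import Data.Rational.Unnormalised as ℚᵘ using (mkℚᵘ; *≡*; *≤*)
import Data.Rational.Unnormalised.Properties as ℚᵘ
open import Data.Sum using ([_,_]′)
open import Function using (_∘_)
open import Relation.Binary.PropositionalEquality
open import Relation.Nullary using (yes; no; contradiction; Dec)
open +-*-Solver using (solve; _:=_; _:+_; _:*_; con)

-- Naturals inside the rationals

ι : ℕ → ℚ
ι m = + m / 1

toℚᵘ-/ : ∀ i d → toℚᵘ (i / suc d) ℚᵘ.≃ mkℚᵘ i d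
toℚᵘ-/ i d = toℚᵘ-fromℚᵘ (mkℚᵘ i d)

ι-+ : ∀ a b → ι (a ℕ.+ b) ≡ ι a + ι b
ι-+ a b = toℚᵘ-injective (begin
  toℚᵘ (ι (a ℕ.+ b))               ≈⟨ toℚᵘ-/ (+ (a ℕ.+ b)) 0 ⟩
  mkℚᵘ (+ (a ℕ.+ b)) 0             ≈⟨ *≡* (cong (ℤ._* + 1) (cong₂ ℤ._+_ (sym (ℤ.*-identityʳ (+ a))) (sym (ℤ.*-identityʳ (+ b))))) ⟩
  mkℚᵘ (+ a) 0 ℚᵘ.+ mkℚᵘ (+ b) 0   ≈⟨ ℚᵘ.+-cong (toℚᵘ-/ (+ a) 0) (toℚᵘ-/ (+ b) 0) ⟨
  toℚᵘ (ι a) ℚᵘ.+ toℚᵘ (ι b)       ≈⟨ toℚᵘ-homo-+ (ι a) (ι b) ⟨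
  toℚᵘ (ι a + ι b)                 ∎)
  where open ℚᵘ.≃-Reasoning

ι-* : ∀ a b → ι (a ℕ.* b) ≡ ι a * ι b
ι-* a b = toℚᵘ-injective (begin
  toℚᵘ (ι (a ℕ.* b))               ≈⟨ toℚᵘ-/ (+ (a ℕ.* b)) 0 ⟩
  mkℚᵘ (+ (a ℕ.* b)) 0             ≈⟨ *≡* (cong (ℤ._* + 1) (ℤ.pos-* a b)) ⟩
  mkℚᵘ (+ a) 0 ℚᵘ.* mkℚᵘ (+ b) 0   ≈⟨ ℚᵘ.*-cong (toℚᵘ-/ (+ a) 0) (toℚᵘ-/ (+ b) 0) ⟨
  toℚᵘ (ι a) ℚᵘ.* toℚᵘ (ι b)       ≈⟨ toℚᵘ-homo-* (ι a) (ι b) ⟨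
  toℚᵘ (ι a * ι b)                 ∎)
  where open ℚᵘ.≃-Reasoning

/-*-ι : ∀ a b .{{_ : ℕ.NonZero b}} → (+ a / b) * ι b ≡ ι a
/-*-ι a b@(suc d) = toℚᵘ-injective (begin
  toℚᵘ ((+ a / b) * ι b)           ≈⟨ toℚᵘ-homo-* (+ a / b) (ι b) ⟩
  toℚᵘ (+ a / b) ℚᵘ.* toℚᵘ (ι b)   ≈⟨ ℚᵘ.*-cong (toℚᵘ-/ (+ a) d) (toℚᵘ-/ (+ b) 0) ⟩
  mkℚᵘ (+ a) d ℚᵘ.* mkℚᵘ (+ b) 0   ≈⟨ *≡* (trans (ℤ.*-identityʳ _) (cong (λ x → + a ℤ.* + x) (sym (ℕ.*-identityʳ b)))) ⟩
  mkℚᵘ (+ a) 0                     ≈⟨ toℚᵘ-/ (+ a) 0 ⟨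
  toℚᵘ (ι a)                       ∎)
  where open ℚᵘ.≃-Reasoning

0≤/ : ∀ a b .{{_ : ℕ.NonZero b}} → 0ℚ ≤ + a / b
0≤/ a b = nonNegative⁻¹ (+ a / b) {{normalize-nonNeg a b}}

0≤ι : ∀ a → 0ℚ ≤ ι a
0≤ι a = 0≤/ a 1

ι-pos : ∀ a .{{_ : ℕ.NonZero a}} → Positive (ι a)
ι-pos a = normalize-pos a 1

p≤p+q : ∀ p {q} → 0ℚ ≤ q → p ≤ p + q
p≤p+q p {q} 0≤q = begin
  p       ≡⟨ +-identityʳ p ⟨
  p + 0ℚ  ≤⟨ +-monoʳ-≤ p 0≤q ⟩
  p + q   ∎
  where open ≤-Reasoning

ι-mono-≤ : ∀ {a b} → a ℕ.≤ b → ι a ≤ ι b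
ι-mono-≤ {a} {b} a≤b = begin
  ι a                  ≤⟨ p≤p+q (ι a) (0≤ι (b ℕ.∸ a)) ⟩
  ι a + ι (b ℕ.∸ a)    ≡⟨ ι-+ a (b ℕ.∸ a) ⟨
  ι (a ℕ.+ (b ℕ.∸ a))  ≡⟨ cong ι (ℕ.m+[n∸m]≡n a≤b) ⟩
  ι b                  ∎
  where open ≤-Reasoning

ι-cancel-≤ : ∀ {a b} → ι a ≤ ι b → a ℕ.≤ b
ι-cancel-≤ {a} {b} ιa≤ιb
  with *≤* le ← ℚᵘ.≤-respʳ-≃ (toℚᵘ-/ (+ b) 0) (ℚᵘ.≤-respˡ-≃ (toℚᵘ-/ (+ a) 0) (toℚᵘ-mono-≤ ιa≤ιb))
  = ℤ.drop‿+≤+ (subst₂ ℤ._≤_ (ℤ.*-identityʳ (+ a)) (ℤ.*-identityʳ (+ b)) le)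

0≤* : ∀ {p q} → 0ℚ ≤ p → 0ℚ ≤ q → 0ℚ ≤ p * q
0≤* {p} {q} 0≤p 0≤q =
  nonNegative⁻¹ (p * q) {{nonNeg*nonNeg⇒nonNeg p {{nonNegative 0≤p}} q {{nonNegative 0≤q}}}}

*-monoʳ : ∀ {p q} r → 0ℚ ≤ r → p ≤ q → p * r ≤ q * r
*-monoʳ r 0≤r = *-monoʳ-≤-nonNeg r {{nonNegative 0≤r}}

*-monoˡ : ∀ {p q} r → 0ℚ ≤ r → p ≤ q → r * p ≤ r * q
*-monoˡ r 0≤r = *-monoˡ-≤-nonNeg r {{nonNegative 0≤r}}

+-cancelʳ-≤ : ∀ {p q} r → p + r ≤ q + r → p ≤ q
+-cancelʳ-≤ {p} {q} r p+r≤q+r = subst₂ _≤_ (cancel p) (cancel q) (+-monoˡ-≤ (- r) p+r≤q+r)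
  where
  cancel : ∀ x → x + r + - r ≡ x
  cancel x = trans (+-assoc x r (- r)) (trans (cong (_+_ x) (+-inverseʳ r)) (+-identityʳ x))

-- Partial sums of the exponential series

expTerm-suc : ∀ x i → expTerm x (suc i) * ι (suc i) ≡ expTerm x i * x
expTerm-suc x i = begin
  expTerm x i * x * (+ 1 / suc i) * ι (suc i)    ≡⟨ *-assoc (expTerm x i * x) _ _ ⟩
  expTerm x i * x * ((+ 1 / suc i) * ι (suc i))  ≡⟨ cong (expTerm x i * x *_) (/-*-ι 1 (suc i)) ⟩
  expTerm x i * x * 1ℚ                           ≡⟨ *-identityʳ _ ⟩
  expTerm x i * x                                ∎
  where open ≡-Reasoning

0≤expTerm : ∀ {x} i → 0ℚ ≤ x → 0ℚ ≤ expTerm x i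
0≤expTerm zero    0≤x = 0≤ι 1
0≤expTerm (suc i) 0≤x = 0≤* (0≤* (0≤expTerm i 0≤x) 0≤x) (0≤/ 1 (suc i))

0≤expPartial : ∀ {x} N → 0ℚ ≤ x → 0ℚ ≤ expPartial x N
0≤expPartial zero    0≤x = 0≤ι 1
0≤expPartial (suc N) 0≤x = ≤-trans (0≤expPartial N 0≤x) (p≤p+q _ (0≤expTerm (suc N) 0≤x))

expTerm-mono-≤ : ∀ {x y} i → 0ℚ ≤ x → x ≤ y → expTerm x i ≤ expTerm y i
expTerm-mono-≤         zero    0≤x x≤y = ≤-refl
expTerm-mono-≤ {x} {y} (suc i) 0≤x x≤y = *-monoʳ (+ 1 / suc i) (0≤/ 1 (suc i)) (≤-trans
  (*-monoʳ x 0≤x (expTerm-mono-≤ i 0≤x x≤y))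
  (*-monoˡ (expTerm y i) (0≤expTerm i (≤-trans 0≤x x≤y)) x≤y))

expPartial-mono-≤ : ∀ {x y} N → 0ℚ ≤ x → x ≤ y → expPartial x N ≤ expPartial y N
expPartial-mono-≤ zero    0≤x x≤y = ≤-refl
expPartial-mono-≤ (suc N) 0≤x x≤y = +-mono-≤ (expPartial-mono-≤ N 0≤x x≤y) (expTerm-mono-≤ (suc N) 0≤x x≤y)

expTerm≤expPartial : ∀ {x} N → 0ℚ ≤ x → expTerm x N ≤ expPartial x N
expTerm≤expPartial zero    0≤x = ≤-refl
expTerm≤expPartial {x} (suc N) 0≤x = begin
  expTerm x (suc N)                  ≡⟨ +-identityˡ _ ⟨
  0ℚ + expTerm x (suc N)             ≤⟨ +-monoˡ-≤ _ (0≤expPartial N 0≤x) ⟩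
  expPartial x N + expTerm x (suc N) ∎
  where open ≤-Reasoning

expTerm-0 : ∀ i → expTerm 0ℚ (suc i) ≡ 0ℚ
expTerm-0 i = trans (cong (_* (+ 1 / suc i)) (*-zeroʳ (expTerm 0ℚ i))) (*-zeroˡ (+ 1 / suc i))

expPartial-0 : ∀ N → expPartial 0ℚ N ≡ 1ℚ
expPartial-0 zero    = refl
expPartial-0 (suc N) = trans (cong₂ _+_ (expPartial-0 N) (expTerm-0 N)) (+-identityʳ 1ℚ)

-- The equation `x ≡ ι a` is kept as a hypothesis because `self-power-bound` has x as a multiple of
-- 1/45, the shape that `expPartial-bound` needs.
expTerm-! : ∀ x i a → x ≡ ι a → expTerm x i * ι (i !) ≡ ι (a ℕ.^ i)
expTerm-! x zero    a x≡ιa = refl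
expTerm-! x (suc i) a x≡ιa = begin
  expTerm x (suc i) * ι (suc i ℕ.* i !)        ≡⟨ cong (expTerm x (suc i) *_) (ι-* (suc i) (i !)) ⟩
  expTerm x (suc i) * (ι (suc i) * ι (i !))    ≡⟨ *-assoc (expTerm x (suc i)) (ι (suc i)) (ι (i !)) ⟨
  expTerm x (suc i) * ι (suc i) * ι (i !)      ≡⟨ cong (_* ι (i !)) (expTerm-suc x i) ⟩
  expTerm x i * x * ι (i !)
    ≡⟨ solve 3 (λ t x f → t :* x :* f := x :* (t :* f)) refl (expTerm x i) x (ι (i !)) ⟩
  x * (expTerm x i * ι (i !))                  ≡⟨ cong₂ _*_ x≡ιa (expTerm-! x i a x≡ιa) ⟩
  ι a * ι (a ℕ.^ i)                            ≡⟨ ι-* a (a ℕ.^ i) ⟨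
  ι (a ℕ.^ suc i)                              ∎
  where open ≡-Reasoning

module _ {y t : ℚ} (0≤y : 0ℚ ≤ y) (0≤t : 0ℚ ≤ t) where

  private
    z = y + t
    0≤z : 0ℚ ≤ z
    0≤z = ≤-trans 0≤y (p≤p+q y 0≤t)

  -- Mean value estimate: expTerm _ i is the derivative of expTerm _ (suc i).
  expTerm-increment : ∀ i → expTerm z (suc i) ≤ expTerm y (suc i) + t * expTerm z i
  expTerm-increment zero = ≤-reflexive
    (solve 2 (λ y t → con 1ℚ :* (y :+ t) :* con 1ℚ := con 1ℚ :* y :* con 1ℚ :+ t :* con 1ℚ) refl y t)
  expTerm-increment (suc i) = *-cancelʳ-≤-pos (ι (suc (suc i))) {{ι-pos (suc (suc i))}} (begin
    expTerm z (suc (suc i)) * ι (suc (suc i))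
      ≡⟨ expTerm-suc z (suc i) ⟩
    Tz * (y + t)
      ≡⟨ *-distribˡ-+ Tz y t ⟩
    Tz * y + Tz * t
      ≤⟨ +-monoˡ-≤ (Tz * t) (*-monoʳ y 0≤y (expTerm-increment i)) ⟩
    (Ty + t * expTerm z i) * y + Tz * t
      ≡⟨ solve 5 (λ a t b y c → (a :+ t :* b) :* y :+ c :* t := (a :* y :+ c :* t) :+ t :* (b :* y)) refl Ty t (expTerm z i) y Tz ⟩
    (Ty * y + Tz * t) + t * (expTerm z i * y)
      -- Enlarging y to z produces `ι (suc i)` further copies of t times `Tz`; with the one already
      -- present they make up the factor `ι (suc (suc i))` to be cancelled.
      ≤⟨ +-monoʳ-≤ (Ty * y + Tz * t) (*-monoˡ t 0≤t (*-monoˡ (expTerm z i) (0≤expTerm i 0≤z) (p≤p+q y 0≤t))) ⟩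
    (Ty * y + Tz * t) + t * (expTerm z i * z)
      ≡⟨ cong₂ (λ a b → (a + Tz * t) + t * b) (expTerm-suc y (suc i)) (expTerm-suc z i) ⟨
    (expTerm y (suc (suc i)) * ι (suc (suc i)) + Tz * t) + t * (Tz * ι (suc i))
      ≡⟨ cong (λ a → (expTerm y (suc (suc i)) * a + Tz * t) + t * (Tz * ι (suc i))) (ι-+ 1 (suc i)) ⟩
    (expTerm y (suc (suc i)) * (1ℚ + ι (suc i)) + Tz * t) + t * (Tz * ι (suc i))
      ≡⟨ solve 4 (λ a n b t → (a :* (con 1ℚ :+ n) :+ b :* t) :+ t :* (b :* n) := (a :+ t :* b) :* (con 1ℚ :+ n))
           refl (expTerm y (suc (suc i))) (ι (suc i)) Tz t ⟩
    (expTerm y (suc (suc i)) + t * Tz) * (1ℚ + ι (suc i))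
      ≡⟨ cong ((expTerm y (suc (suc i)) + t * Tz) *_) (ι-+ 1 (suc i)) ⟨
    (expTerm y (suc (suc i)) + t * Tz) * ι (suc (suc i)) ∎)
    where
    open ≤-Reasoning
    Tz = expTerm z (suc i)
    Ty = expTerm y (suc i)

  expPartial-increment : ∀ N → expPartial z (suc N) ≤ expPartial y (suc N) + t * expPartial z N
  expPartial-increment zero    = begin
    1ℚ + expTerm z 1                   ≤⟨ +-monoʳ-≤ 1ℚ (expTerm-increment 0) ⟩
    1ℚ + (expTerm y 1 + t * 1ℚ)        ≡⟨ +-assoc 1ℚ (expTerm y 1) (t * 1ℚ) ⟨
    1ℚ + expTerm y 1 + t * 1ℚ          ∎
    where open ≤-Reasoning
  expPartial-increment (suc N) = begin
    expPartial z (suc N) + expTerm z (suc (suc N))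
      ≤⟨ +-mono-≤ (expPartial-increment N) (expTerm-increment (suc N)) ⟩
    (expPartial y (suc N) + t * expPartial z N) + (expTerm y (suc (suc N)) + t * expTerm z (suc N))
      ≡⟨ solve 5 (λ a t b c d → (a :+ t :* b) :+ (c :+ t :* d) := (a :+ c) :+ t :* (b :+ d)) refl
           (expPartial y (suc N)) t (expPartial z N) (expTerm y (suc (suc N))) (expTerm z (suc N)) ⟩
    expPartial y (suc (suc N)) + t * expPartial z (suc N) ∎
    where open ≤-Reasoning

  -- This is (1 - t) exp (y + t) ≤ exp y without subtraction. Both sides are truncated at the same
  -- order, so that it can be iterated.
  expPartial-+ : ∀ N → expPartial z N ≤ expPartial y N + t * expPartial z N
  expPartial-+ zero    = p≤p+q 1ℚ (0≤* 0≤t (0≤ι 1))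
  expPartial-+ (suc N) = ≤-trans (expPartial-increment N) (+-monoʳ-≤ (expPartial y (suc N))
    (*-monoˡ t 0≤t (p≤p+q (expPartial z N) (0≤expTerm (suc N) 0≤z))))

-- exp (m t) ≤ (1 - t) ^ (- m) for t = a / (r + a), with denominators cleared.
expPartial-bound : ∀ {t} r a → 0ℚ ≤ t → t * ι (r ℕ.+ a) ≡ ι a → ∀ N m →
  expPartial (ι m * t) N * ι (r ℕ.^ m) ≤ ι ((r ℕ.+ a) ℕ.^ m)
expPartial-bound {t} r a 0≤t t-frac N zero = ≤-reflexive (cong (_* 1ℚ)
  (trans (cong (λ x → expPartial x N) (*-zeroˡ t)) (expPartial-0 N)))
expPartial-bound {t} r a 0≤t t-frac N (suc m) = begin
  expPartial (ι (suc m) * t) N * ι (r ℕ.* r ℕ.^ m)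
    ≡⟨ cong₂ (λ x y → expPartial x N * y) 1+m (ι-* r (r ℕ.^ m)) ⟩
  Ez * (ι r * ι (r ℕ.^ m))
    ≡⟨ *-assoc Ez (ι r) (ι (r ℕ.^ m)) ⟨
  Ez * ι r * ι (r ℕ.^ m)
    ≤⟨ *-monoʳ (ι (r ℕ.^ m)) (0≤ι (r ℕ.^ m)) step ⟩
  Ey * ι s * ι (r ℕ.^ m)
    ≡⟨ solve 3 (λ e s x → e :* s :* x := s :* (e :* x)) refl Ey (ι s) (ι (r ℕ.^ m)) ⟩
  ι s * (Ey * ι (r ℕ.^ m))
    ≤⟨ *-monoˡ (ι s) (0≤ι s) (expPartial-bound r a 0≤t t-frac N m) ⟩
  ι s * ι (s ℕ.^ m)
    ≡⟨ ι-* s (s ℕ.^ m) ⟨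
  ι (s ℕ.^ suc m) ∎
  where
  open ≤-Reasoning
  s = r ℕ.+ a
  Ez = expPartial (ι m * t + t) N
  Ey = expPartial (ι m * t) N
  1+m : ι (suc m) * t ≡ ι m * t + t
  1+m = trans (cong (_* t) (ι-+ 1 m)) (solve 2 (λ x t → (con 1ℚ :+ x) :* t := x :* t :+ t) refl (ι m) t)
  -- As 1 - t = r/s, this is `expPartial-+` scaled by s; adding `Ez * ι a` on both sides avoids the
  -- subtraction.
  step : Ez * ι r ≤ Ey * ι s
  step = +-cancelʳ-≤ (Ez * ι a) (begin
    Ez * ι r + Ez * ι a        ≡⟨ trans (cong (Ez *_) (ι-+ r a)) (*-distribˡ-+ Ez (ι r) (ι a)) ⟨
    Ez * ι s                   ≤⟨ *-monoʳ (ι s) (0≤ι s) (expPartial-+ (0≤* (0≤ι m) 0≤t) 0≤t N) ⟩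
    (Ey + t * Ez) * ι s
      ≡⟨ solve 4 (λ e t f s → (e :+ t :* f) :* s := e :* s :+ f :* (t :* s)) refl Ey t Ez (ι s) ⟩
    Ey * ι s + Ez * (t * ι s)  ≡⟨ cong (λ x → Ey * ι s + Ez * x) t-frac ⟩
    Ey * ι s + Ez * ι a        ∎)

-- expPartial-bound at t = 1/64, m = 88: a small t is needed, as exp (11/8) is about 3.955.
expPartial-11/8 : ∀ N → expPartial (+ 11 / 8) N ≤ ι 4
expPartial-11/8 N = *-cancelʳ-≤-pos (ι (63 ℕ.^ 88)) {{ι-pos (63 ℕ.^ 88) {{ℕ.m^n≢0 63 88}}}} (begin
  -- `ι 88 * (+ 1 / 64)` computes to 11/8, and the comparison of powers that follows is decided by
  -- evaluation. Denominators divisible by 8 make m integral; the next smaller one, 56, would give a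
  -- bound above 4.
  expPartial (+ 11 / 8) N * ι (63 ℕ.^ 88)  ≤⟨ expPartial-bound 63 1 (0≤/ 1 64) (/-*-ι 1 64) N 88 ⟩
  ι (64 ℕ.^ 88)                            ≤⟨ ι-mono-≤ (ℕ.≤ᵇ⇒≤ (64 ℕ.^ 88) (4 ℕ.* 63 ℕ.^ 88) _) ⟩
  ι (4 ℕ.* 63 ℕ.^ 88)                      ≡⟨ ι-* 4 (63 ℕ.^ 88) ⟩
  ι 4 * ι (63 ℕ.^ 88)                      ∎)
  where open ≤-Reasoning

-- Power inequalities and extraction of roots

^-distribʳ-* : ∀ m n o → (m ℕ.* n) ℕ.^ o ≡ m ℕ.^ o ℕ.* n ℕ.^ o
^-distribʳ-* m n zero    = refl
^-distribʳ-* m n (suc o) = trans (cong (m ℕ.* n ℕ.*_) (^-distribʳ-* m n o)) (regroup m n (m ℕ.^ o) (n ℕ.^ o))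
  where
  regroup : ∀ m n x y → m ℕ.* n ℕ.* (x ℕ.* y) ≡ m ℕ.* x ℕ.* (n ℕ.* y)
  regroup = ℕ-RingSolver.solve-∀

^-comm : ∀ x a b → (x ℕ.^ a) ℕ.^ b ≡ (x ℕ.^ b) ℕ.^ a
^-comm x a b = trans (ℕ.^-*-assoc x a b) (trans (cong (x ℕ.^_) (ℕ.*-comm a b)) (sym (ℕ.^-*-assoc x b a)))

^-cancelʳ-≤ : ∀ {x y} n .{{_ : ℕ.NonZero n}} → x ℕ.^ n ℕ.≤ y ℕ.^ n → x ℕ.≤ y
^-cancelʳ-≤ n x^n≤y^n = ℕ.≮⇒≥ λ y<x → ℕ.<⇒≱ (ℕ.^-monoˡ-< n y<x) x^n≤y^n

-- (1 - a/s)^N ≥ 1 - Na/s with denominators cleared. Truncated subtraction removes all side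
-- conditions: the induction step only compares a r with s a for r ≤ s.
bernoulli : ∀ s a N → s ℕ.^ N ℕ.* (s ℕ.∸ N ℕ.* a) ℕ.≤ (s ℕ.∸ a) ℕ.^ N ℕ.* s
bernoulli s a zero    = ℕ.≤-refl
bernoulli s a (suc N) = begin
  s ℕ.* s ℕ.^ N ℕ.* (s ℕ.∸ (a ℕ.+ N ℕ.* a))  ≡⟨ regroup₁ s (s ℕ.^ N) _ ⟩
  s ℕ.^ N ℕ.* (s ℕ.* (s ℕ.∸ (a ℕ.+ N ℕ.* a))) ≤⟨ ℕ.*-monoʳ-≤ (s ℕ.^ N) step ⟩
  s ℕ.^ N ℕ.* ((s ℕ.∸ a) ℕ.* r)              ≡⟨ regroup₂ (s ℕ.^ N) (s ℕ.∸ a) r ⟩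
  (s ℕ.∸ a) ℕ.* (s ℕ.^ N ℕ.* r)              ≤⟨ ℕ.*-monoʳ-≤ (s ℕ.∸ a) (bernoulli s a N) ⟩
  (s ℕ.∸ a) ℕ.* ((s ℕ.∸ a) ℕ.^ N ℕ.* s)      ≡⟨ ℕ.*-assoc (s ℕ.∸ a) _ s ⟨
  (s ℕ.∸ a) ℕ.* (s ℕ.∸ a) ℕ.^ N ℕ.* s        ∎
  where
  open ℕ.≤-Reasoning
  r = s ℕ.∸ N ℕ.* a
  regroup₁ : ∀ s x y → s ℕ.* x ℕ.* y ≡ x ℕ.* (s ℕ.* y)
  regroup₁ = ℕ-RingSolver.solve-∀
  regroup₂ : ∀ x y r → x ℕ.* (y ℕ.* r) ≡ y ℕ.* (x ℕ.* r)
  regroup₂ = ℕ-RingSolver.solve-∀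
  step : s ℕ.* (s ℕ.∸ (a ℕ.+ N ℕ.* a)) ℕ.≤ (s ℕ.∸ a) ℕ.* r
  step = begin
    s ℕ.* (s ℕ.∸ (a ℕ.+ N ℕ.* a))  ≡⟨ cong (λ x → s ℕ.* (s ℕ.∸ x)) (ℕ.+-comm a (N ℕ.* a)) ⟩
    s ℕ.* (s ℕ.∸ (N ℕ.* a ℕ.+ a))  ≡⟨ cong (s ℕ.*_) (ℕ.∸-+-assoc s (N ℕ.* a) a) ⟨
    s ℕ.* (r ℕ.∸ a)                ≡⟨ ℕ.*-distribˡ-∸ s r a ⟩
    s ℕ.* r ℕ.∸ s ℕ.* a
      ≤⟨ ℕ.∸-monoʳ-≤ (s ℕ.* r) (ℕ.≤-trans (ℕ.≤-reflexive (ℕ.*-comm a r)) (ℕ.*-monoˡ-≤ a (ℕ.m∸n≤m s (N ℕ.* a)))) ⟩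
    s ℕ.* r ℕ.∸ a ℕ.* r            ≡⟨ ℕ.*-distribʳ-∸ r s a ⟨
    (s ℕ.∸ a) ℕ.* r                ∎

-- The number j^j / j! is one term of the series of exp j, and j = 45j · (1/45) lets
-- `expPartial-bound` bound that series by (45/44)^(45j).
self-power-bound : ∀ j → j ℕ.^ j ℕ.* 44 ℕ.^ (45 ℕ.* j) ℕ.≤ 45 ℕ.^ (45 ℕ.* j) ℕ.* j !
self-power-bound j = ι-cancel-≤ (begin
  ι (j ℕ.^ j ℕ.* 44 ℕ.^ (45 ℕ.* j))               ≡⟨ ι-* (j ℕ.^ j) _ ⟩
  ι (j ℕ.^ j) * ι (44 ℕ.^ (45 ℕ.* j))             ≡⟨ cong (_* ι (44 ℕ.^ (45 ℕ.* j))) (expTerm-! x j j x≡ιj) ⟨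
  expTerm x j * ι (j !) * ι (44 ℕ.^ (45 ℕ.* j))
    ≤⟨ *-monoʳ _ (0≤ι (44 ℕ.^ (45 ℕ.* j))) (*-monoʳ _ (0≤ι (j !)) (expTerm≤expPartial j 0≤x)) ⟩
  expPartial x j * ι (j !) * ι (44 ℕ.^ (45 ℕ.* j))
    ≡⟨ solve 3 (λ a b c → a :* b :* c := (a :* c) :* b) refl (expPartial x j) (ι (j !)) (ι (44 ℕ.^ (45 ℕ.* j))) ⟩
  expPartial x j * ι (44 ℕ.^ (45 ℕ.* j)) * ι (j !)
    ≤⟨ *-monoʳ _ (0≤ι (j !)) (expPartial-bound 44 1 (0≤/ 1 45) (/-*-ι 1 45) j (45 ℕ.* j)) ⟩
  ι (45 ℕ.^ (45 ℕ.* j)) * ι (j !)                 ≡⟨ ι-* (45 ℕ.^ (45 ℕ.* j)) (j !) ⟨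
  ι (45 ℕ.^ (45 ℕ.* j) ℕ.* j !)                   ∎)
  where
  open ≤-Reasoning
  x = ι (45 ℕ.* j) * (+ 1 / 45)
  x≡ιj : x ≡ ι j
  x≡ιj = trans (cong (_* (+ 1 / 45)) (ι-* 45 j)) (trans
    (solve 3 (λ a b c → a :* b :* c := (c :* a) :* b) refl (ι 45) (ι j) (+ 1 / 45))
    (*-identityˡ (ι j)))
  0≤x : 0ℚ ≤ x
  0≤x = 0≤* (0≤ι (45 ℕ.* j)) (0≤/ 1 45)

-- j! ≥ (j / e) ^ j with e replaced by 11/4, from j^j / j! ≤ exp j and
-- e ≤ (44/45)^(-45) ≤ 11/4.
factorial-bound : ∀ j → (4 ℕ.* j) ℕ.^ j ℕ.≤ 11 ℕ.^ j ℕ.* j !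
factorial-bound j = ℕ.*-cancelʳ-≤ _ _ (44 ℕ.^ (45 ℕ.* j)) {{ℕ.m^n≢0 44 (45 ℕ.* j)}} (begin
  (4 ℕ.* j) ℕ.^ j ℕ.* 44 ℕ.^ (45 ℕ.* j)
    ≡⟨ cong (ℕ._* 44 ℕ.^ (45 ℕ.* j)) (^-distribʳ-* 4 j j) ⟩
  4 ℕ.^ j ℕ.* j ℕ.^ j ℕ.* 44 ℕ.^ (45 ℕ.* j)
    ≡⟨ ℕ.*-assoc (4 ℕ.^ j) (j ℕ.^ j) _ ⟩
  4 ℕ.^ j ℕ.* (j ℕ.^ j ℕ.* 44 ℕ.^ (45 ℕ.* j))
    ≤⟨ ℕ.*-monoʳ-≤ (4 ℕ.^ j) (self-power-bound j) ⟩
  4 ℕ.^ j ℕ.* (45 ℕ.^ (45 ℕ.* j) ℕ.* j !)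
    ≡⟨ ℕ.*-assoc (4 ℕ.^ j) _ (j !) ⟨
  4 ℕ.^ j ℕ.* 45 ℕ.^ (45 ℕ.* j) ℕ.* j !
    ≤⟨ ℕ.*-monoˡ-≤ (j !) e-bound ⟩
  11 ℕ.^ j ℕ.* 44 ℕ.^ (45 ℕ.* j) ℕ.* j !
    ≡⟨ regroup (11 ℕ.^ j) (44 ℕ.^ (45 ℕ.* j)) (j !) ⟩
  11 ℕ.^ j ℕ.* j ! ℕ.* 44 ℕ.^ (45 ℕ.* j) ∎)
  where
  open ℕ.≤-Reasoning
  regroup : ∀ x y z → x ℕ.* y ℕ.* z ≡ x ℕ.* z ℕ.* y
  regroup = ℕ-RingSolver.solve-∀
  -- The j-th power of a numerical inequality decided by evaluation; (45/44)^45 is about 2.749.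
  e-bound : 4 ℕ.^ j ℕ.* 45 ℕ.^ (45 ℕ.* j) ℕ.≤ 11 ℕ.^ j ℕ.* 44 ℕ.^ (45 ℕ.* j)
  e-bound = subst₂ ℕ._≤_ (expand 4 45) (expand 11 44)
    (ℕ.^-monoˡ-≤ j (ℕ.≤ᵇ⇒≤ (4 ℕ.* 45 ℕ.^ 45) (11 ℕ.* 44 ℕ.^ 45) _))
    where
    expand : ∀ c x → (c ℕ.* x ℕ.^ 45) ℕ.^ j ≡ c ℕ.^ j ℕ.* x ℕ.^ (45 ℕ.* j)
    expand c x = trans (^-distribʳ-* c (x ℕ.^ 45) j) (cong (c ℕ.^ j ℕ.*_) (ℕ.^-*-assoc x 45 j))

-- The first moment bound C(k,j)^N (1 - j/k)^(jM) ≥ 1, after C(k,j) ≤ (11k/4j)^j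
-- and extraction of a j-th root.
first-moment-root : ∀ k j N M L .{{_ : ℕ.NonZero j}} → L ℕ.* j ! ℕ.≤ k ℕ.^ j →
  (k ℕ.^ j) ℕ.^ M ℕ.≤ L ℕ.^ N ℕ.* ((k ℕ.∸ j) ℕ.^ j) ℕ.^ M →
  (4 ℕ.* j) ℕ.^ N ℕ.* k ℕ.^ M ℕ.≤ (11 ℕ.* k) ℕ.^ N ℕ.* (k ℕ.∸ j) ℕ.^ M
first-moment-root k j N M L L-bound moment = ^-cancelʳ-≤ j (begin
  ((4 ℕ.* j) ℕ.^ N ℕ.* k ℕ.^ M) ℕ.^ j
    ≡⟨ powers (4 ℕ.* j) k ⟩
  ((4 ℕ.* j) ℕ.^ j) ℕ.^ N ℕ.* (k ℕ.^ j) ℕ.^ M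
    ≤⟨ ℕ.*-mono-≤ (ℕ.^-monoˡ-≤ N (factorial-bound j)) moment ⟩
  (11 ℕ.^ j ℕ.* j !) ℕ.^ N ℕ.* (L ℕ.^ N ℕ.* K)
    ≡⟨ ℕ.*-assoc ((11 ℕ.^ j ℕ.* j !) ℕ.^ N) (L ℕ.^ N) K ⟨
  (11 ℕ.^ j ℕ.* j !) ℕ.^ N ℕ.* L ℕ.^ N ℕ.* K
    ≡⟨ cong (ℕ._* K) (^-distribʳ-* (11 ℕ.^ j ℕ.* j !) L N) ⟨
  (11 ℕ.^ j ℕ.* j ! ℕ.* L) ℕ.^ N ℕ.* K
    ≤⟨ ℕ.*-monoˡ-≤ K (ℕ.^-monoˡ-≤ N base) ⟩
  ((11 ℕ.* k) ℕ.^ j) ℕ.^ N ℕ.* K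
    ≡⟨ powers (11 ℕ.* k) (k ℕ.∸ j) ⟨
  ((11 ℕ.* k) ℕ.^ N ℕ.* (k ℕ.∸ j) ℕ.^ M) ℕ.^ j ∎)
  where
  open ℕ.≤-Reasoning
  K = ((k ℕ.∸ j) ℕ.^ j) ℕ.^ M
  powers : ∀ x y → (x ℕ.^ N ℕ.* y ℕ.^ M) ℕ.^ j ≡ (x ℕ.^ j) ℕ.^ N ℕ.* (y ℕ.^ j) ℕ.^ M
  powers x y = trans (^-distribʳ-* (x ℕ.^ N) (y ℕ.^ M) j) (cong₂ ℕ._*_ (^-comm x N j) (^-comm y M j))
  base : 11 ℕ.^ j ℕ.* j ! ℕ.* L ℕ.≤ (11 ℕ.* k) ℕ.^ j
  base = begin
    11 ℕ.^ j ℕ.* j ! ℕ.* L    ≡⟨ trans (ℕ.*-assoc (11 ℕ.^ j) _ L) (cong (11 ℕ.^ j ℕ.*_) (ℕ.*-comm (j !) L)) ⟩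
    11 ℕ.^ j ℕ.* (L ℕ.* j !)  ≤⟨ ℕ.*-monoʳ-≤ (11 ℕ.^ j) L-bound ⟩
    11 ℕ.^ j ℕ.* k ℕ.^ j      ≡⟨ ^-distribʳ-* 11 k j ⟨
    (11 ℕ.* k) ℕ.^ j          ∎

-- Bernoulli's inequality (1 - j/(kN))^N ≥ 1 - j/k allows a further N-th root.
first-moment-root-N : ∀ k j N M .{{_ : ℕ.NonZero k}} .{{_ : ℕ.NonZero N}} →
  (4 ℕ.* j) ℕ.^ N ℕ.* k ℕ.^ M ℕ.≤ (11 ℕ.* k) ℕ.^ N ℕ.* (k ℕ.∸ j) ℕ.^ M →
  4 ℕ.* j ℕ.* (k ℕ.* N) ℕ.^ M ℕ.≤ 11 ℕ.* k ℕ.* (k ℕ.* N ℕ.∸ j) ℕ.^ M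
first-moment-root-N k j N M hyp = ^-cancelʳ-≤ N (ℕ.*-cancelʳ-≤ _ _ (k ℕ.^ M) {{ℕ.m^n≢0 k M}} (begin
  (4 ℕ.* j ℕ.* s ℕ.^ M) ℕ.^ N ℕ.* k ℕ.^ M
    ≡⟨ cong (ℕ._* k ℕ.^ M) (^-distribʳ-* (4 ℕ.* j) (s ℕ.^ M) N) ⟩
  (4 ℕ.* j) ℕ.^ N ℕ.* (s ℕ.^ M) ℕ.^ N ℕ.* k ℕ.^ M
    ≡⟨ regroup₁ ((4 ℕ.* j) ℕ.^ N) ((s ℕ.^ M) ℕ.^ N) (k ℕ.^ M) ⟩
  (4 ℕ.* j) ℕ.^ N ℕ.* k ℕ.^ M ℕ.* (s ℕ.^ M) ℕ.^ N
    ≤⟨ ℕ.*-monoˡ-≤ ((s ℕ.^ M) ℕ.^ N) hyp ⟩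
  (11 ℕ.* k) ℕ.^ N ℕ.* (k ℕ.∸ j) ℕ.^ M ℕ.* (s ℕ.^ M) ℕ.^ N
    ≡⟨ ℕ.*-assoc ((11 ℕ.* k) ℕ.^ N) _ _ ⟩
  (11 ℕ.* k) ℕ.^ N ℕ.* ((k ℕ.∸ j) ℕ.^ M ℕ.* (s ℕ.^ M) ℕ.^ N)
    ≤⟨ ℕ.*-monoʳ-≤ ((11 ℕ.* k) ℕ.^ N) by-bernoulli ⟩
  (11 ℕ.* k) ℕ.^ N ℕ.* ((r ℕ.^ M) ℕ.^ N ℕ.* k ℕ.^ M)
    ≡⟨ ℕ.*-assoc ((11 ℕ.* k) ℕ.^ N) _ _ ⟨
  (11 ℕ.* k) ℕ.^ N ℕ.* (r ℕ.^ M) ℕ.^ N ℕ.* k ℕ.^ M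
    ≡⟨ cong (ℕ._* k ℕ.^ M) (^-distribʳ-* (11 ℕ.* k) (r ℕ.^ M) N) ⟨
  (11 ℕ.* k ℕ.* r ℕ.^ M) ℕ.^ N ℕ.* k ℕ.^ M ∎))
  where
  open ℕ.≤-Reasoning
  s = k ℕ.* N
  r = s ℕ.∸ j
  regroup₁ : ∀ x y z → x ℕ.* y ℕ.* z ≡ x ℕ.* z ℕ.* y
  regroup₁ = ℕ-RingSolver.solve-∀
  regroup₂ : ∀ x k n → x ℕ.* (k ℕ.* n) ≡ x ℕ.* k ℕ.* n
  regroup₂ = ℕ-RingSolver.solve-∀
  -- `bernoulli` at s = kN, where s - Nj = (k - j)N; the common factor N cancels.
  linear : (k ℕ.∸ j) ℕ.* s ℕ.^ N ℕ.≤ r ℕ.^ N ℕ.* k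
  linear = ℕ.*-cancelʳ-≤ _ _ N (begin
    (k ℕ.∸ j) ℕ.* s ℕ.^ N ℕ.* N       ≡⟨ regroup₃ (k ℕ.∸ j) (s ℕ.^ N) N ⟩
    s ℕ.^ N ℕ.* ((k ℕ.∸ j) ℕ.* N)
      ≡⟨ cong (s ℕ.^ N ℕ.*_) (trans (ℕ.*-distribʳ-∸ N k j) (cong (s ℕ.∸_) (ℕ.*-comm j N))) ⟩
    s ℕ.^ N ℕ.* (s ℕ.∸ N ℕ.* j)       ≤⟨ bernoulli s j N ⟩
    r ℕ.^ N ℕ.* (k ℕ.* N)             ≡⟨ regroup₂ (r ℕ.^ N) k N ⟩
    r ℕ.^ N ℕ.* k ℕ.* N               ∎)
    where
    regroup₃ : ∀ x y n → x ℕ.* y ℕ.* n ≡ y ℕ.* (x ℕ.* n)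
    regroup₃ = ℕ-RingSolver.solve-∀
  by-bernoulli : (k ℕ.∸ j) ℕ.^ M ℕ.* (s ℕ.^ M) ℕ.^ N ℕ.≤ (r ℕ.^ M) ℕ.^ N ℕ.* k ℕ.^ M
  by-bernoulli = begin
    (k ℕ.∸ j) ℕ.^ M ℕ.* (s ℕ.^ M) ℕ.^ N   ≡⟨ cong ((k ℕ.∸ j) ℕ.^ M ℕ.*_) (^-comm s M N) ⟩
    (k ℕ.∸ j) ℕ.^ M ℕ.* (s ℕ.^ N) ℕ.^ M   ≡⟨ ^-distribʳ-* (k ℕ.∸ j) (s ℕ.^ N) M ⟨
    ((k ℕ.∸ j) ℕ.* s ℕ.^ N) ℕ.^ M         ≤⟨ ℕ.^-monoˡ-≤ M linear ⟩
    (r ℕ.^ N ℕ.* k) ℕ.^ M                 ≡⟨ ^-distribʳ-* (r ℕ.^ N) k M ⟩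
    (r ℕ.^ N) ℕ.^ M ℕ.* k ℕ.^ M           ≡⟨ cong (ℕ._* k ℕ.^ M) (^-comm r N M) ⟩
    (r ℕ.^ M) ℕ.^ N ℕ.* k ℕ.^ M           ∎

-- With denominators cleared: exp (jM / (kN)) ≤ (11/4) (k/j).
expPartial-η : ∀ k j N M {t} .{{_ : ℕ.NonZero k}} .{{_ : ℕ.NonZero N}} → j ℕ.≤ k →
  0ℚ ≤ t → t * ι (k ℕ.* N) ≡ ι j →
  4 ℕ.* j ℕ.* (k ℕ.* N) ℕ.^ M ℕ.≤ 11 ℕ.* k ℕ.* (k ℕ.* N ℕ.∸ j) ℕ.^ M →
  ∀ n → expPartial (ι M * t) n * ι (4 ℕ.* j) ≤ ι (11 ℕ.* k)
expPartial-η k j N M {t} j≤k 0≤t t-frac hyp n = *-cancelʳ-≤-pos (ι sᴹ) {{ι-pos sᴹ {{ℕ.m^n≢0 s M {{ℕ.m*n≢0 k N}}}}}} (begin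
  y * ι (4 ℕ.* j) * ι sᴹ         ≡⟨ trans (*-assoc y _ _) (cong (y *_) (sym (ι-* (4 ℕ.* j) sᴹ))) ⟩
  y * ι (4 ℕ.* j ℕ.* sᴹ)         ≤⟨ *-monoˡ y (0≤expPartial n (0≤* (0≤ι M) 0≤t)) (ι-mono-≤ hyp) ⟩
  y * ι (11 ℕ.* k ℕ.* rᴹ)        ≡⟨ cong (y *_) (ι-* (11 ℕ.* k) rᴹ) ⟩
  y * (ι (11 ℕ.* k) * ι rᴹ)
    ≡⟨ solve 3 (λ a b c → a :* (b :* c) := b :* (a :* c)) refl y (ι (11 ℕ.* k)) (ι rᴹ) ⟩
  ι (11 ℕ.* k) * (y * ι rᴹ)      ≤⟨ *-monoˡ (ι (11 ℕ.* k)) (0≤ι (11 ℕ.* k)) bound ⟩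
  ι (11 ℕ.* k) * ι sᴹ            ∎)
  where
  open ≤-Reasoning
  s = k ℕ.* N
  sᴹ = s ℕ.^ M
  rᴹ = (s ℕ.∸ j) ℕ.^ M
  y = expPartial (ι M * t) n
  s∸j+j : s ℕ.∸ j ℕ.+ j ≡ s
  s∸j+j = ℕ.m∸n+n≡m (ℕ.≤-trans j≤k (ℕ.m≤m*n k N))
  bound : y * ι rᴹ ≤ ι sᴹ
  bound = subst (λ x → y * ι rᴹ ≤ ι (x ℕ.^ M)) s∸j+j
    (expPartial-bound (s ℕ.∸ j) j 0≤t (trans (cong (λ x → t * ι x) s∸j+j) t-frac) n M)

-- The bound for a densest subgraph and the conclusion

rooted-first-moment : ∀ {G} (H : Subgraph G) {k j} .{{_ : ℕ.NonZero k}} .{{_ : ℕ.NonZero ∣ S H ∣}} → j ℕ.≤ k →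
  (∀ (𝓗 : Cover G k) → ∃ λ col → QuasiIndependent 𝓗 col × (∀ u → ∣ col u ∣ ≡ j)) →
  4 ℕ.* j ℕ.* (k ℕ.* ∣ S H ∣) ℕ.^ edgeCount H ℕ.≤ 11 ℕ.* k ℕ.* (k ℕ.* ∣ S H ∣ ℕ.∸ j) ℕ.^ edgeCount H
-- No root of order j = 0 can be taken, but then the left side is 0.
rooted-first-moment H {k} {zero}  j≤k colorable = z≤n
rooted-first-moment H {k} {suc j} j≤k colorable = first-moment-root-N k (suc j) ∣ S H ∣ (edgeCount H)
  (first-moment-root k (suc j) ∣ S H ∣ (edgeCount H) _ (length-subsets k (suc j)) (first-moment H j≤k colorable))

least : ∀ {P : ℕ → Set} → (∀ i → Dec (P i)) → ∀ m → P m → ∃ λ j → j ℕ.≤ m × P j × (∀ i → P i → j ℕ.≤ i)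
least P? m Pm with P? 0
least P? m       Pm | yes P0 = 0 , z≤n , P0 , λ _ _ → z≤n
least P? zero    Pm | no ¬P0 = contradiction Pm ¬P0
least P? (suc m) Pm | no ¬P0 with j , j≤m , Pj , j-least ← least (P? ∘ suc) m Pm
  = suc j , s≤s j≤m , Pj , λ where
    zero    P0  → contradiction P0 ¬P0
    (suc i) Psi → s≤s (j-least i Psi)

module _ {k N M j : ℕ} {{_ : ℕ.NonZero k}} {{_ : ℕ.NonZero N}} {θ d : ℚ}
  (d*N : d * ι N ≡ ι (2 ℕ.* M)) (4≤d : ι 4 ≤ d)
  (0≤θ : 0ℚ ≤ θ) (θk≤j : θ * ι k ≤ ι j) (j≤k : j ℕ.≤ k)
  (rooted : 4 ℕ.* j ℕ.* (k ℕ.* N) ℕ.^ M ℕ.≤ 11 ℕ.* k ℕ.* (k ℕ.* N ℕ.∸ j) ℕ.^ M) where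

  private
    s = k ℕ.* N
    instance
      s≢0 : ℕ.NonZero s
      s≢0 = ℕ.m*n≢0 k N
    t = + j / s
    x = ι M * t

    0≤t : 0ℚ ≤ t
    0≤t = 0≤/ j s
    0≤d : 0ℚ ≤ d
    0≤d = ≤-trans (0≤ι 4) 4≤d
    0≤x : 0ℚ ≤ x
    0≤x = 0≤* (0≤ι M) 0≤t

    xs≡Mj : x * ι s ≡ ι M * ι j
    xs≡Mj = trans (*-assoc (ι M) t (ι s)) (cong (ι M *_) (/-*-ι j s))

    -- x is the product of j/k ≥ θ and M/N = d/2.
    θd/2≤x : θ * d * ½ ≤ x
    θd/2≤x = *-cancelʳ-≤-pos (ι s) {{ι-pos s}} (begin
      θ * d * ½ * ι s             ≡⟨ cong (θ * d * ½ *_) (ι-* k N) ⟩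
      θ * d * ½ * (ι k * ι N)
        ≡⟨ solve 5 (λ θ d h k n → θ :* d :* h :* (k :* n) := (θ :* k) :* (h :* (d :* n))) refl θ d ½ (ι k) (ι N) ⟩
      θ * ι k * (½ * (d * ι N))   ≡⟨ cong (λ a → θ * ι k * (½ * a)) (trans d*N (ι-* 2 M)) ⟩
      θ * ι k * (½ * (ι 2 * ι M))
        ≡⟨ cong (θ * ι k *_) (trans (sym (*-assoc ½ (ι 2) (ι M))) (*-identityˡ (ι M))) ⟩
      θ * ι k * ι M               ≤⟨ *-monoʳ (ι M) (0≤ι M) θk≤j ⟩
      ι j * ι M                   ≡⟨ trans (*-comm (ι j) (ι M)) (sym xs≡Mj) ⟩
      x * ι s                     ∎)
      where open ≤-Reasoning

    -- (11/8) exp x ≤ x exp x ≤ (11/4)(M/N) = (11/8) d, scaled by 8s. No division by j occurs.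
    exp-x≤d : ∀ n → + 11 / 8 ≤ x → expPartial x n ≤ d
    exp-x≤d n 11/8≤x = *-cancelˡ-≤-pos (ι 11 * ι s) {{pos*pos⇒pos (ι 11) (ι s) {{ι-pos s}}}} (begin
      ι 11 * ι s * y
        ≡⟨ solve 3 (λ a s y → a :* s :* y := (a :* y) :* s) refl (ι 11) (ι s) y ⟩
      ι 11 * y * ι s
        ≤⟨ *-monoʳ (ι s) (0≤ι s) (*-monoʳ y (0≤expPartial n 0≤x) (*-monoˡ (ι 8) (0≤ι 8) 11/8≤x)) ⟩
      ι 8 * x * y * ι s
        -- `ι 8` computes to `ι 2 * ι 4`: the 4 completes `4 * j` for `expPartial-η`, the 2
        -- completes `2 * M`, which is d N.
        ≡⟨ solve 5 (λ a b x y s → (a :* b) :* x :* y :* s := a :* (y :* b :* (x :* s))) refl (ι 2) (ι 4) x y (ι s) ⟩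
      ι 2 * (y * ι 4 * (x * ι s))        ≡⟨ cong (λ a → ι 2 * (y * ι 4 * a)) xs≡Mj ⟩
      ι 2 * (y * ι 4 * (ι M * ι j))
        ≡⟨ solve 5 (λ a y b m j → a :* (y :* b :* (m :* j)) := (y :* (b :* j)) :* (a :* m)) refl (ι 2) y (ι 4) (ι M) (ι j) ⟩
      y * (ι 4 * ι j) * (ι 2 * ι M)      ≡⟨ cong₂ (λ a b → y * a * b) (ι-* 4 j) (ι-* 2 M) ⟨
      y * ι (4 ℕ.* j) * ι (2 ℕ.* M)
        ≤⟨ *-monoʳ (ι (2 ℕ.* M)) (0≤ι (2 ℕ.* M)) (expPartial-η k j N M j≤k 0≤t (/-*-ι j s) rooted n) ⟩
      ι (11 ℕ.* k) * ι (2 ℕ.* M)         ≡⟨ cong₂ _*_ (ι-* 11 k) (sym d*N) ⟩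
      ι 11 * ι k * (d * ι N)
        ≡⟨ solve 4 (λ a k d n → a :* k :* (d :* n) := a :* (k :* n) :* d) refl (ι 11) (ι k) d (ι N) ⟩
      ι 11 * (ι k * ι N) * d             ≡⟨ cong (λ a → ι 11 * a * d) (ι-* k N) ⟨
      ι 11 * ι s * d                     ∎)
      where
      open ≤-Reasoning
      y = expPartial x n

  leLn-bound : LeLn (θ * d * ½) d
  leLn-bound n = ≤-trans (expPartial-mono-≤ n (0≤* (0≤* 0≤θ 0≤d) (0≤/ 1 2)) θd/2≤x)
    ([ (λ x≤11/8 → ≤-trans (expPartial-mono-≤ n 0≤x x≤11/8) (≤-trans (expPartial-11/8 n) 4≤d))
     , exp-x≤d n ]′ (≤-total x (+ 11 / 8)))

-- Class sizes are integers, so being at least θk they are at least j, the ceiling of θk.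
-- Quasi-independence passes to subsets, so each class can be cut down to exactly j elements.
uniform-coloring : ∀ {G k θ j} → AdmitsAll G k θ → (∀ i → θ * ι k ≤ ι i → j ℕ.≤ i) →
  ∀ (𝓗 : Cover G k) → ∃ λ col → QuasiIndependent 𝓗 col × (∀ u → ∣ col u ∣ ≡ j)
uniform-coloring {k = k} {j = j} admits j-least 𝓗 = (λ u → proj₁ (shrunk u))
  , (λ u v a b e a∈ b∈ → C.quasi-ind u v a b e (proj₁ (proj₂ (shrunk u)) a∈) (proj₁ (proj₂ (shrunk v)) b∈))
  , (λ u → proj₂ (proj₂ (shrunk u)))
  where
  module C = Coloring (admits 𝓗)
  shrunk : ∀ u → ∃ λ q → q Subset.⊆ C.col u × ∣ q ∣ ≡ j
  shrunk u = shrink-⊆ (C.col u) (j-least ∣ C.col u ∣ (C.large u))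

theorem1p7 : (G : Graph) (d : ℚ) → IsMad G d → (+ 4 / 1) ≤ d
    → ChiDPStarAtLeastDOver2LnD G d
theorem1p7 G d ((H , N≢0 , avgDeg≡d) , _) 4≤d k k≢0 θ (0≤θ , θ≤1 , admits , _) =
  -- θ ≤ 1 makes k itself admissible, so the search for the ceiling of θk stops at some j ≤ k.
  bound (least (λ i → θ * ι k ≤? ι i) k (≤-trans (*-monoʳ (ι k) (0≤ι k) θ≤1) (≤-reflexive (*-identityˡ (ι k)))))
  where
  d*N : d * ι ∣ S H ∣ ≡ ι (2 ℕ.* edgeCount H)
  d*N = trans (cong (_* ι ∣ S H ∣) (sym avgDeg≡d)) (/-*-ι (2 ℕ.* edgeCount H) ∣ S H ∣ {{N≢0}})
  bound : (∃ λ j → j ℕ.≤ k × θ * ι k ≤ ι j × (∀ i → θ * ι k ≤ ι i → j ℕ.≤ i)) → LeLn (θ * d * ½) d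
  bound (j , j≤k , θk≤j , j-least) = leLn-bound {k} {∣ S H ∣} {edgeCount H} {{k≢0}} {{N≢0}} d*N 4≤d 0≤θ θk≤j j≤k
    (rooted-first-moment H {{k≢0}} {{N≢0}} j≤k (uniform-coloring admits j-least))
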